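{- Let $(a_m)_{m\ge 0}$ be an arbitrary sequence of complex numbers with $a_0=0$, let $t$ be a complex number with $t\neq 0$ and $t\neq 1$, and let $n$ be a positive integer. Then $$\sum_{\pi\in P(n)} t^{k(\pi)-1}\left(\frac{t-1}{t}\right)^{Q(\pi)-1}\sum_{j=1}^{s(\pi)}\left(a_{l(\pi)-s(\pi)+j}-t\,a_{l(\pi)-s(\pi)+j-1}\right)=\sum_{d\mid n} a_d,$$ where the sum on the right is over all positive divisors $d$ of $n$.
   Context: A partition of a positive integer $n$ is a sequence $\pi=(k_1,k_2,\dots)$ of non-negative integers, only finitely many nonzero, with $n=\sum_{j\ge1} j k_j$; the integer $k_j$ is the multiplicity of the part $j$, and the parts of $\pi$ are the $j$ with $k_j>0$. $P(n)$ denotes the set of all partitions of $n$. For $\pi\in P(n)$: $k(\pi)=\sum_j k_j$ is the total number of parts (counted with multiplicity), $Q(\pi)=\#\{j: k_j>0\}$ is the number of distinct parts, $s(\pi)$ is the smallest part, and $l(\pi)$ is the largest part. -}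

module Defs where

open import Algebra.Apartness.Bundles using (HeytingCommutativeRing; HeytingField)
open import Algebra.Bundles using (CommutativeRing)
open import Data.Fin.Base using (Fin; zero; suc; toℕ)
open import Data.List.Base as List
  using (List; []; _∷_; allFin; cartesianProductWith; filter; length; upTo)
open import Data.List.Extrema.Nat using (max; min)
open import Data.List.Membership.Propositional using (_∈_)
open import Data.List.Membership.Propositional.Properties
  using (∈-cartesianProductWith⁺; ∈-filter⁺; ∈-filter⁻; ∈-upTo⁺)
open import Data.List.Relation.Unary.Any using (here)
open import Data.List.Relation.Unary.AllPairs using ([]; _∷_)
open import Data.List.Relation.Unary.All using ([])
open import Data.List.Relation.Unary.Unique.Propositional using (Unique)
open import Data.List.Relation.Unary.Unique.Propositional.Properties
  using (cartesianProductWith⁺; filter⁺; upTo⁺)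
open import Data.Nat.Base using (ℕ; suc; _+_; _*_; _≤_; s≤s)
open import Data.Nat.Divisibility using (_∣?_)
open import Data.Nat.Properties
  using (_≟_; _<?_; m≤m+n; m≤n+m; m≤n*m; ≤-trans; ≤-reflexive)
open import Data.Product.Base using (_,_; proj₁; proj₂)
open import Data.Vec.Base using (Vec; []; _∷_; lookup; sum; tabulate)
open import Data.Vec.Properties using (∷-injective)
open import Function.Base using (_∘_)
open import Function.Bundles using (_⇔_; mk⇔)
open import Relation.Binary.PropositionalEquality using (_≡_; refl)

-- [1⋯ n ] = 1 , 2 , … , n
[1⋯_] : ℕ → List ℕ
[1⋯ n ] = List.map suc (upTo n)

divisors : ℕ → List ℕ
divisors n = filter (_∣? n) [1⋯ n ]

------------------------------------------------------------------------
-- Partitions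

-- A partition (k₁ , k₂ , …) of n has j kⱼ ≤ n for every j, hence kⱼ = 0 for
-- j > n, so it is recorded by (k₁ , … , kₙ).  The multiplicity of the part
-- j = 1 + toℕ i is stored at the index i.

part : ∀ {m} → Fin m → ℕ
part i = suc (toℕ i)

-- Σⱼ j kⱼ
weight : ∀ {m} → Vec ℕ m → ℕ
weight π = sum (tabulate λ i → part i * lookup π i)

IsPartition : (n : ℕ) → Vec ℕ n → Set
IsPartition n π = weight π ≡ n

-- All vectors of length m with entries at most b.
boundedVecs : ℕ → (m : ℕ) → List (Vec ℕ m)
boundedVecs b 0       = [] ∷ []
boundedVecs b (suc m) = cartesianProductWith _∷_ (upTo (suc b)) (boundedVecs b m)

-- The set P(n): the bound n on the multiplicities is no restriction, and
-- nothing is listed twice (∈-P and P-unique below).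
P : (n : ℕ) → List (Vec ℕ n)
P n = filter (λ π → weight π ≟ n) (boundedVecs n n)

module _ {m : ℕ} (π : Vec ℕ m) where

  -- The distinct parts, in increasing order.
  parts : List ℕ
  parts = List.map part (filter (λ i → 0 <? lookup π i) (allFin m))

  #parts : ℕ
  #parts = sum π

  #distinctParts : ℕ
  #distinctParts = length parts

  -- The first argument of min and max is the value at the empty list.  Parts
  -- lie between 1 and m, so it plays no role as soon as there is a part.
  smallestPart : ℕ
  smallestPart = min m parts

  largestPart : ℕ
  largestPart = max 0 parts

private
  lookup≤sum : ∀ {m} (v : Vec ℕ m) i → lookup v i ≤ sum v
  lookup≤sum (x ∷ v) zero    = m≤m+n x (sum v)
  lookup≤sum (x ∷ v) (suc i) = ≤-trans (lookup≤sum v i) (m≤n+m (sum v) x)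

  lookup≤sum-tabulate : ∀ {m} (f : Fin m → ℕ) i → f i ≤ sum (tabulate f)
  lookup≤sum-tabulate f zero    = m≤m+n (f zero) _
  lookup≤sum-tabulate f (suc i) =
    ≤-trans (lookup≤sum-tabulate (f ∘ suc) i) (m≤n+m _ (f zero))

  lookup≤weight : ∀ {m} (π : Vec ℕ m) i → lookup π i ≤ weight π
  lookup≤weight π i = ≤-trans (m≤n*m (lookup π i) (part i))
    (lookup≤sum-tabulate (λ i → part i * lookup π i) i)

  ∈-boundedVecs : ∀ {b m} (v : Vec ℕ m) → (∀ i → lookup v i ≤ b) →
                  v ∈ boundedVecs b m
  ∈-boundedVecs []      v≤b = here refl
  ∈-boundedVecs (x ∷ v) v≤b = ∈-cartesianProductWith⁺ _∷_
    (∈-upTo⁺ (s≤s (v≤b zero))) (∈-boundedVecs v (v≤b ∘ suc))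

  boundedVecs-unique : ∀ b m → Unique (boundedVecs b m)
  boundedVecs-unique b 0       = [] ∷ []
  boundedVecs-unique b (suc m) = cartesianProductWith⁺ _∷_ ∷-injective
    (upTo⁺ (suc b)) (boundedVecs-unique b m)

∈-P : ∀ {n} (π : Vec ℕ n) → π ∈ P n ⇔ IsPartition n π
∈-P {n} π = mk⇔
  (λ π∈P → proj₂ (∈-filter⁻ (λ π → weight π ≟ n) {xs = boundedVecs n n} π∈P))
  (λ eq → ∈-filter⁺ (λ π → weight π ≟ n)
    (∈-boundedVecs π (λ i → ≤-trans (lookup≤weight π i) (≤-reflexive eq))) eq)

P-unique : ∀ n → Unique (P n)
P-unique n = filter⁺ (λ π → weight π ≟ n) (boundedVecs-unique n n)

------------------------------------------------------------------------
-- Fields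

module FieldOperations {c ℓ₁ ℓ₂} (F : HeytingField c ℓ₁ ℓ₂) where

  open HeytingField F
    using (Carrier; _≈_; _#_; 0#; 1#; #⇒invertible; trans; sym; *-congʳ;
           heytingCommutativeRing)
    renaming (_+_ to _+ᶠ_; _*_ to _*ᶠ_)
  open HeytingCommutativeRing heytingCommutativeRing using (commutativeRing)
  open import Algebra.Apartness.Properties.HeytingCommutativeRing
    heytingCommutativeRing using (x-0≈x)
  open import Algebra.Properties.Semiring.Exp
    (CommutativeRing.semiring commutativeRing) public using (_^_)

  infixl 7 _/_[_]

  -- #⇒invertible supplies an inverse of y - 0#, which is one of y.
  _⁻¹[_] : (y : Carrier) → y # 0# → Carrier
  y ⁻¹[ y#0 ] = proj₁ (#⇒invertible y#0)

  ⁻¹-inverseʳ : ∀ y (y#0 : y # 0#) → y *ᶠ y ⁻¹[ y#0 ] ≈ 1#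
  ⁻¹-inverseʳ y y#0 =
    trans (*-congʳ (sym (x-0≈x y))) (proj₂ (proj₂ (#⇒invertible y#0)))

  _/_[_] : Carrier → (y : Carrier) → y # 0# → Carrier
  x / y [ y#0 ] = x *ᶠ y ⁻¹[ y#0 ]

  ∑ : ∀ {a} {A : Set a} → List A → (A → Carrier) → Carrier
  ∑ xs f = List.foldr _+ᶠ_ 0# (List.map f xs)

  infix 5 ∑
  syntax ∑ xs (λ x → e) = ∑[ x ∈ xs ] e

{-# OPTIONS --safe #-}

-- Put τ = t - 1, h_j = x^j / (1 - t x^j) and f_j = 1 + τ h_j = (1 - x^j) / (1 - t x^j).
-- Up to the factor τ, the weight t^{k(π)-1} ((t-1)/t)^{Q(π)-1} is a product of local
-- weights over the parts, so the partitions with largest part p + i and smallest part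
-- > p have the generating function f_{p+1} ⋯ f_{p+i-1} h_{p+i}.  Let Γ_i be its sum over
-- p ≥ 0.  The inner sum of the theorem adds a_i - t a_{i-1} for the i with
-- l(π) - s(π) < i ≤ l(π), so by Abel summation the coefficient of a_i on the left is
-- Γ_i - t Γ_{i+1}.  From h_{p+i} (1 + t h_p) = x^i h_p (1 + t h_{p+i}) the sum over p
-- telescopes to
--   Γ_i - t Γ_{i+1} = x^i (Γ_i - t Γ_{i+1} + 1),
-- that is, Γ_i - t Γ_{i+1} = x^i + x^{2i} + ⋯ .

module Submission where

open import Defs
open import Algebra.Apartness.Bundles using (HeytingField; HeytingCommutativeRing)
open import Algebra.Bundles using (CommutativeRing; CommutativeSemiring)
open import Algebra.Structures.Biased using (isCommutativeSemiringˡ)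
open import Data.Bool.Base using (Bool; true; false; if_then_else_)
open import Data.Fin.Base as Fin using (Fin; zero; suc; toℕ)
import Data.Fin.Properties as Fin
open import Data.List.Base as List
  using (List; []; _∷_; _++_; _∷ʳ_; allFin; cartesianProductWith; filter; length; upTo)
open import Data.List.Extrema.Nat
  using (argmax-sel; argmin-sel; max≤v⁺; min≤xs; xs≤max)
open import Data.List.Membership.Propositional using (_∈_)
open import Data.List.Membership.Propositional.Properties
  using (∈-allFin; ∈-filter⁺; ∈-filter⁻; ∈-length; ∈-map⁺; ∈-map⁻; ∈-upTo⁻)
open import Data.List.Properties
  using (length-map; map-applyUpTo; map-tabulate; map-upTo; upTo-∷ʳ)
open import Data.List.Relation.Unary.All as All using ()
open import Data.List.Relation.Unary.Any using (here; there)
open import Data.Nat.Base as ℕ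
  using (ℕ; zero; suc; _∸_; _≤_; _<_; NonZero; s≤s; z≤n)
open import Data.Nat.Divisibility
  using (_∣_; _∣?_; ∣-refl; ∣m+n∣m⇒∣n; ∣m∣n⇒∣m+n; ∣⇒≤)
open import Data.Nat.Induction using (<-rec)
import Data.Nat.Properties as ℕ
open import Data.Product.Base using (∃-syntax; _×_; _,_; proj₁; proj₂)
open import Data.Sum.Base using (inj₁; inj₂)
open import Data.Vec.Base as Vec using (Vec; []; _∷_; lookup; tabulate)
open import Function.Base using (_∘_; id)
open import Function.Bundles using (Equivalence; mk⇔)
open import Relation.Binary.PropositionalEquality as ≡ using (_≡_; _≢_)
open import Relation.Binary.Structures using (IsEquivalence)
open import Relation.Nullary
  using (Dec; yes; no; does; _×-dec_; ¬_; contradiction)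
open import Relation.Nullary.Decidable using (dec-false; dec-true; does-⇔)
open import Relation.Unary using (Decidable)

-- Throughout, `r` stands for i - 1. A partition is counted once for every `p` below its smallest
-- part, together with i = l(π) - p. As `p` varies, this i runs through exactly the range of the
-- inner sum; hence the smallest part is only bounded from below. Infinite sums are avoided by
-- computing modulo x^(n+1): there h_j is a finite geometric sum, h_j = 0 and f_j = 1 for j > n, and
-- the sum over `p` may stop at n. Truncated series form only a commutative semiring here. Fractions
-- are therefore replaced by the equation h_j = x^j (1 + t h_j), t is written as 1 + τ, and negative
-- terms are moved across. Subtraction is needed only for single coefficients: to cancel a common
-- term in the recurrence, and for a_i - t a_{i-1} itself. The factor τ is kept until the end, where
-- t ≠ 1 makes it invertible.

if-yes : ∀ {a p} {A : Set a} {P : Set p} {x y : A} (P? : Dec P) → P →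
         (if does P? then x else y) ≡ x
if-yes P? p = ≡.cong (if_then _ else _) (dec-true P? p)

if-no : ∀ {a p} {A : Set a} {P : Set p} {x y : A} (P? : Dec P) → ¬ P →
        (if does P? then x else y) ≡ y
if-no P? ¬p = ≡.cong (if_then _ else _) (dec-false P? ¬p)

-- Finite sums and products in a commutative semiring.

module BigOperators {c ℓ} (R : CommutativeSemiring c ℓ) where
  open CommutativeSemiring R
  open import Relation.Binary.Reasoning.Setoid setoid
  open import Algebra.Properties.CommutativeSemigroup +-commutativeSemigroup
    using (interchange)

  ∑ : ∀ {a} {A : Set a} → List A → (A → Carrier) → Carrier
  ∑ xs f = List.foldr _+_ 0# (List.map f xs)

  infix 5 ∑
  syntax ∑ xs (λ x → e) = ∑[ x ∈ xs ] e

  ∏ : ℕ → (ℕ → Carrier) → Carrier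
  ∏ zero    f = 1#
  ∏ (suc n) f = f 0 * ∏ n (f ∘ suc)

  module _ {a} {A : Set a} where

    ∑-cong-∈ : ∀ (xs : List A) {f g} → (∀ {x} → x ∈ xs → f x ≈ g x) → ∑ xs f ≈ ∑ xs g
    ∑-cong-∈ []       f≈g = refl
    ∑-cong-∈ (x ∷ xs) f≈g = +-cong (f≈g (here ≡.refl)) (∑-cong-∈ xs (f≈g ∘ there))

    ∑-cong : ∀ (xs : List A) {f g} → (∀ x → f x ≈ g x) → ∑ xs f ≈ ∑ xs g
    ∑-cong xs f≈g = ∑-cong-∈ xs (λ {x} _ → f≈g x)

    ∑-zero : ∀ (xs : List A) {f} → (∀ {x} → x ∈ xs → f x ≈ 0#) → ∑ xs f ≈ 0#
    ∑-zero []       f≈0 = refl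
    ∑-zero (x ∷ xs) f≈0 =
      trans (+-cong (f≈0 (here ≡.refl)) (∑-zero xs (f≈0 ∘ there))) (+-identityˡ 0#)

    ∑-+ : ∀ (xs : List A) f g → ∑[ x ∈ xs ] (f x + g x) ≈ ∑ xs f + ∑ xs g
    ∑-+ []       f g = sym (+-identityˡ 0#)
    ∑-+ (x ∷ xs) f g = trans (+-congˡ (∑-+ xs f g)) (interchange (f x) (g x) _ _)

    *-∑ : ∀ y (xs : List A) f → y * ∑ xs f ≈ ∑[ x ∈ xs ] (y * f x)
    *-∑ y []       f = zeroʳ y
    *-∑ y (x ∷ xs) f = trans (distribˡ y (f x) _) (+-congˡ (*-∑ y xs f))

    ∑-* : ∀ y (xs : List A) f → ∑ xs f * y ≈ ∑[ x ∈ xs ] (f x * y)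
    ∑-* y xs f = trans (*-comm _ y) (trans (*-∑ y xs f) (∑-cong xs (λ x → *-comm y (f x))))

    ∑-++ : ∀ (xs ys : List A) f → ∑ (xs ++ ys) f ≈ ∑ xs f + ∑ ys f
    ∑-++ []       ys f = sym (+-identityˡ _)
    ∑-++ (x ∷ xs) ys f = trans (+-congˡ (∑-++ xs ys f)) (sym (+-assoc (f x) _ _))

    ∑-map : ∀ {b} {B : Set b} (g : B → A) xs f → ∑ (List.map g xs) f ≈ ∑ xs (f ∘ g)
    ∑-map g []       f = refl
    ∑-map g (x ∷ xs) f = +-congˡ (∑-map g xs f)

    ∑-filter : ∀ {p} {P : A → Set p} (P? : Decidable P) xs f →
               ∑ (filter P? xs) f ≈ ∑[ x ∈ xs ] (if does (P? x) then f x else 0#)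
    ∑-filter P? []       f = refl
    ∑-filter P? (x ∷ xs) f with does (P? x)
    ... | true  = +-congˡ (∑-filter P? xs f)
    ... | false = trans (∑-filter P? xs f) (sym (+-identityˡ _))

  ∑-swap : ∀ {a b} {A : Set a} {B : Set b} (xs : List A) (ys : List B) (f : A → B → Carrier) →
           ∑[ x ∈ xs ] ∑[ y ∈ ys ] f x y ≈ ∑[ y ∈ ys ] ∑[ x ∈ xs ] f x y
  ∑-swap []       ys f = sym (∑-zero ys (λ _ → refl))
  ∑-swap (x ∷ xs) ys f =
    trans (+-congˡ (∑-swap xs ys f)) (sym (∑-+ ys (f x) (λ y → ∑[ x ∈ xs ] f x y)))

  ∑-cartesianProductWith :
    ∀ {a b d} {A : Set a} {B : Set b} {D : Set d} (_∙_ : A → B → D) xs ys f →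
    ∑ (cartesianProductWith _∙_ xs ys) f ≈ ∑[ x ∈ xs ] ∑[ y ∈ ys ] f (x ∙ y)
  ∑-cartesianProductWith _∙_ []       ys f = refl
  ∑-cartesianProductWith _∙_ (x ∷ xs) ys f =
    trans (∑-++ (List.map (x ∙_) ys) _ f)
      (+-cong (∑-map (x ∙_) ys f) (∑-cartesianProductWith _∙_ xs ys f))

  ∑-upTo-suc : ∀ n f → ∑ (upTo (suc n)) f ≈ f 0 + ∑ (upTo n) (f ∘ suc)
  ∑-upTo-suc n f = +-congˡ (reflexive (≡.cong (List.foldr _+_ 0#)
    (≡.trans (map-applyUpTo suc f n) (≡.sym (map-upTo (f ∘ suc) n)))))

  ∑-upTo-∷ʳ : ∀ n f → ∑ (upTo (suc n)) f ≈ ∑ (upTo n) f + f n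
  ∑-upTo-∷ʳ n f = begin
    ∑ (upTo (suc n)) f               ≡⟨ ≡.cong (λ xs → ∑ xs f) (upTo-∷ʳ n) ⟨
    ∑ (upTo n ∷ʳ n) f                ≈⟨ ∑-++ (upTo n) (n ∷ []) f ⟩
    ∑ (upTo n) f + (f n + 0#)        ≈⟨ +-congˡ (+-identityʳ (f n)) ⟩
    ∑ (upTo n) f + f n               ∎

  ∑-upTo-reverse : ∀ n f → ∑ (upTo n) f ≈ ∑[ k ∈ upTo n ] f (n ∸ suc k)
  ∑-upTo-reverse zero    f = refl
  ∑-upTo-reverse (suc n) f = begin
    ∑ (upTo (suc n)) f                         ≈⟨ ∑-upTo-∷ʳ n f ⟩
    ∑ (upTo n) f + f n                         ≈⟨ +-comm _ (f n) ⟩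
    f n + ∑ (upTo n) f                         ≈⟨ +-congˡ (∑-upTo-reverse n f) ⟩
    f n + (∑[ k ∈ upTo n ] f (n ∸ suc k))      ≈⟨ ∑-upTo-suc n (λ k → f (n ∸ k)) ⟨
    ∑[ k ∈ upTo (suc n) ] f (n ∸ k)            ∎


  ∑-upTo-single : ∀ {n m} f → m < n → (∀ {k} → k ≢ m → f k ≈ 0#) → ∑ (upTo n) f ≈ f m
  ∑-upTo-single {suc n} {zero} f (s≤s _) f≈0 = begin
    ∑ (upTo (suc n)) f              ≈⟨ ∑-upTo-suc n f ⟩
    f 0 + ∑ (upTo n) (f ∘ suc)      ≈⟨ +-congˡ (∑-zero (upTo n) (λ _ → f≈0 λ ())) ⟩
    f 0 + 0#                        ≈⟨ +-identityʳ (f 0) ⟩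
    f 0                             ∎
  ∑-upTo-single {suc n} {suc m} f (s≤s m<n) f≈0 = begin
    ∑ (upTo (suc n)) f              ≈⟨ ∑-upTo-suc n f ⟩
    f 0 + ∑ (upTo n) (f ∘ suc)      ≈⟨ +-cong (f≈0 λ ())
      (∑-upTo-single (f ∘ suc) m<n (λ k≢m → f≈0 (k≢m ∘ ℕ.suc-injective))) ⟩
    0# + f (suc m)                  ≈⟨ +-identityˡ _ ⟩
    f (suc m)                       ∎

  ∏-cong : ∀ n {f g} → (∀ k → k < n → f k ≈ g k) → ∏ n f ≈ ∏ n g
  ∏-cong zero    f≈g = refl
  ∏-cong (suc n) f≈g = *-cong (f≈g 0 (s≤s z≤n)) (∏-cong n (λ k k<n → f≈g (suc k) (s≤s k<n)))

  ∏-one : ∀ n {f} → (∀ k → k < n → f k ≈ 1#) → ∏ n f ≈ 1#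
  ∏-one zero    f≈1 = refl
  ∏-one (suc n) f≈1 = trans
    (*-cong (f≈1 0 (s≤s z≤n)) (∏-one n (λ k k<n → f≈1 (suc k) (s≤s k<n))))
    (*-identityˡ 1#)

  ∏-+ : ∀ m n f → ∏ (m ℕ.+ n) f ≈ ∏ m f * ∏ n (λ k → f (m ℕ.+ k))
  ∏-+ zero    n f = sym (*-identityˡ _)
  ∏-+ (suc m) n f = trans (*-congˡ (∏-+ m n (f ∘ suc))) (sym (*-assoc (f 0) _ _))

-- Formal power series and their truncations.

-- The power series Σ u i xⁱ is the sequence u.
module PowerSeries {c ℓ} (K : CommutativeSemiring c ℓ) where
  open CommutativeSemiring K
  open import Relation.Binary.Reasoning.Setoid setoid
  open import Algebra.Properties.CommutativeSemigroup +-commutativeSemigroup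
    using (interchange; x∙yz≈y∙xz)

  Series : Set c
  Series = ℕ → Carrier

  0ˢ 1ˢ : Series
  0ˢ _ = 0#

  monomial : Carrier → ℕ → Series
  monomial x zero    zero    = x
  monomial x zero    (suc i) = 0#
  monomial x (suc e) zero    = 0#
  monomial x (suc e) (suc i) = monomial x e i

  1ˢ = monomial 1# 0

  infixl 6 _⊕_
  infixl 7 _⊛_

  _⊕_ _⊛_ : Series → Series → Series
  (u ⊕ v) i = u i + v i
  (u ⊛ v) zero    = u 0 * v 0
  (u ⊛ v) (suc i) = u 0 * v (suc i) + (u ∘ suc ⊛ v) i

  -- Coefficient `n` of a product involves only coefficients up to `n`; this makes agreement up to
  -- degree N a congruence for `_⊛_` in `truncated`.
  ⊛-cong : ∀ {u u′ v v′} n → (∀ i → i ≤ n → u i ≈ u′ i) → (∀ i → i ≤ n → v i ≈ v′ i) →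
           (u ⊛ v) n ≈ (u′ ⊛ v′) n
  ⊛-cong zero    u≈ v≈ = *-cong (u≈ 0 z≤n) (v≈ 0 z≤n)
  ⊛-cong (suc n) u≈ v≈ = +-cong (*-cong (u≈ 0 z≤n) (v≈ (suc n) ℕ.≤-refl))
    (⊛-cong n (λ i i≤n → u≈ (suc i) (s≤s i≤n)) (λ i i≤n → v≈ i (ℕ.m≤n⇒m≤1+n i≤n)))

  ⊛-distribʳ : ∀ u v w n → ((v ⊕ w) ⊛ u) n ≈ (v ⊛ u) n + (w ⊛ u) n
  ⊛-distribʳ u v w zero    = distribʳ (u 0) (v 0) (w 0)
  ⊛-distribʳ u v w (suc n) =
    trans (+-cong (distribʳ (u (suc n)) (v 0) (w 0)) (⊛-distribʳ u (v ∘ suc) (w ∘ suc) n))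
          (interchange _ _ _ _)

  scale-⊛ : ∀ x u v n → ((λ i → x * u i) ⊛ v) n ≈ x * (u ⊛ v) n
  scale-⊛ x u v zero    = *-assoc x (u 0) (v 0)
  scale-⊛ x u v (suc n) =
    trans (+-cong (*-assoc x (u 0) (v (suc n))) (scale-⊛ x (u ∘ suc) v n))
          (sym (distribˡ x _ _))

  ⊛-zeroˡ : ∀ v n → (0ˢ ⊛ v) n ≈ 0#
  ⊛-zeroˡ v zero    = zeroˡ (v 0)
  ⊛-zeroˡ v (suc n) = trans (+-cong (zeroˡ (v (suc n))) (⊛-zeroˡ v n)) (+-identityˡ 0#)

  constant-⊛ : ∀ x v n → (monomial x 0 ⊛ v) n ≈ x * v n
  constant-⊛ x v zero    = refl
  constant-⊛ x v (suc n) = trans (+-congˡ (⊛-zeroˡ v n)) (+-identityʳ _)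

  -- The defining recursion of _⊛_ with the two factors exchanged.
  ⊛-suc : ∀ u v n → (u ⊛ v) (suc n) ≈ u (suc n) * v 0 + (u ⊛ (v ∘ suc)) n
  ⊛-suc u v zero    = +-comm _ _
  ⊛-suc u v (suc n) = trans (+-congˡ (⊛-suc (u ∘ suc) v n)) (x∙yz≈y∙xz _ _ _)

  ⊛-comm : ∀ u v n → (u ⊛ v) n ≈ (v ⊛ u) n
  ⊛-comm u v zero    = *-comm (u 0) (v 0)
  ⊛-comm u v (suc n) = trans (+-cong (*-comm (u 0) (v (suc n))) (⊛-comm (u ∘ suc) v n))
                             (sym (⊛-suc v u n))

  ⊛-assoc : ∀ u v w n → ((u ⊛ v) ⊛ w) n ≈ (u ⊛ (v ⊛ w)) n
  ⊛-assoc u v w zero    = *-assoc (u 0) (v 0) (w 0)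
  ⊛-assoc u v w (suc n) = begin
    u 0 * v 0 * w (suc n) + ((λ i → u 0 * v (suc i) + (u ∘ suc ⊛ v) i) ⊛ w) n
      ≈⟨ +-cong (*-assoc (u 0) (v 0) (w (suc n))) (⊛-distribʳ w _ _ n) ⟩
    u 0 * (v 0 * w (suc n)) + (((λ i → u 0 * v (suc i)) ⊛ w) n + ((u ∘ suc ⊛ v) ⊛ w) n)
      ≈⟨ +-congˡ (+-cong (scale-⊛ (u 0) (v ∘ suc) w n) (⊛-assoc (u ∘ suc) v w n)) ⟩
    u 0 * (v 0 * w (suc n)) + (u 0 * (v ∘ suc ⊛ w) n + (u ∘ suc ⊛ (v ⊛ w)) n)
      ≈⟨ +-assoc _ _ _ ⟨
    u 0 * (v 0 * w (suc n)) + u 0 * (v ∘ suc ⊛ w) n + (u ∘ suc ⊛ (v ⊛ w)) n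
      ≈⟨ +-congʳ (distribˡ (u 0) _ _) ⟨
    u 0 * (v 0 * w (suc n) + (v ∘ suc ⊛ w) n) + (u ∘ suc ⊛ (v ⊛ w)) n
      ∎

  monomial-⊛-≥ : ∀ x e v i → (monomial x e ⊛ v) (e ℕ.+ i) ≈ x * v i
  monomial-⊛-≥ x zero    v i = constant-⊛ x v i
  monomial-⊛-≥ x (suc e) v i =
    trans (+-cong (zeroˡ _) (monomial-⊛-≥ x e v i)) (+-identityˡ _)

  monomial-⊛-< : ∀ x {e} v {i} → i < e → (monomial x e ⊛ v) i ≈ 0#
  monomial-⊛-< x {suc e} v {zero}  i<e       = zeroˡ (v 0)
  monomial-⊛-< x {suc e} v {suc i} (s≤s i<e) =
    trans (+-cong (zeroˡ _) (monomial-⊛-< x v i<e)) (+-identityˡ 0#)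

  monomial-≡ : ∀ x e → monomial x e e ≡ x
  monomial-≡ x zero    = ≡.refl
  monomial-≡ x (suc e) = monomial-≡ x e

  monomial-≢ : ∀ x {e i} → e ≢ i → monomial x e i ≡ 0#
  monomial-≢ x {zero}  {zero}  e≢i = contradiction ≡.refl e≢i
  monomial-≢ x {zero}  {suc i} e≢i = ≡.refl
  monomial-≢ x {suc e} {zero}  e≢i = ≡.refl
  monomial-≢ x {suc e} {suc i} e≢i = monomial-≢ x (e≢i ∘ ≡.cong suc)

  monomial-cong : ∀ {x y} e i → x ≈ y → monomial x e i ≈ monomial y e i
  monomial-cong zero    zero    x≈y = x≈y
  monomial-cong zero    (suc i) x≈y = refl
  monomial-cong (suc e) zero    x≈y = refl
  monomial-cong (suc e) (suc i) x≈y = monomial-cong e i x≈y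

  monomial-zero : ∀ e i → monomial 0# e i ≈ 0#
  monomial-zero zero    zero    = refl
  monomial-zero zero    (suc i) = refl
  monomial-zero (suc e) zero    = refl
  monomial-zero (suc e) (suc i) = monomial-zero e i

  monomial-+ : ∀ x y e i → monomial (x + y) e i ≈ monomial x e i + monomial y e i
  monomial-+ x y zero    zero    = refl
  monomial-+ x y zero    (suc i) = sym (+-identityˡ 0#)
  monomial-+ x y (suc e) zero    = sym (+-identityˡ 0#)
  monomial-+ x y (suc e) (suc i) = monomial-+ x y e i

  scale-monomial : ∀ x y e i → x * monomial y e i ≈ monomial (x * y) e i
  scale-monomial x y zero    zero    = refl
  scale-monomial x y zero    (suc i) = zeroʳ x
  scale-monomial x y (suc e) zero    = zeroʳ x
  scale-monomial x y (suc e) (suc i) = scale-monomial x y e i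

  monomial-* : ∀ x y d e i → (monomial x d ⊛ monomial y e) i ≈ monomial (x * y) (d ℕ.+ e) i
  monomial-* x y zero    e i       = trans (constant-⊛ x (monomial y e) i) (scale-monomial x y e i)
  monomial-* x y (suc d) e zero    = zeroˡ _
  monomial-* x y (suc d) e (suc i) =
    trans (+-cong (zeroˡ _) (monomial-* x y d e i)) (+-identityˡ _)

  -- Power series modulo x ^ suc N.
  truncated : ℕ → CommutativeSemiring c ℓ
  truncated N = record
    { Carrier = Series
    ; _≈_     = λ u v → ∀ i → i ≤ N → u i ≈ v i
    ; _+_     = _⊕_
    ; _*_     = _⊛_
    ; 0#      = 0ˢ
    ; 1#      = 1ˢ
    ; isCommutativeSemiring = isCommutativeSemiringˡ record
      { +-isCommutativeMonoid = record
        { isMonoid = record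
          { isSemigroup = record
            { isMagma = record
              { isEquivalence = isEquivalenceˢ
              ; ∙-cong = λ u≈ v≈ i i≤N → +-cong (u≈ i i≤N) (v≈ i i≤N)
              }
            ; assoc = λ u v w i _ → +-assoc (u i) (v i) (w i)
            }
          ; identity = (λ u i _ → +-identityˡ (u i)) , (λ u i _ → +-identityʳ (u i))
          }
        ; comm = λ u v i _ → +-comm (u i) (v i)
        }
      ; *-isCommutativeMonoid = record
        { isMonoid = record
          { isSemigroup = record
            { isMagma = record
              { isEquivalence = isEquivalenceˢ
              ; ∙-cong = λ u≈ v≈ n n≤N → ⊛-cong n
                  (λ i i≤n → u≈ i (ℕ.≤-trans i≤n n≤N)) (λ i i≤n → v≈ i (ℕ.≤-trans i≤n n≤N))
              }
            ; assoc = λ u v w i _ → ⊛-assoc u v w i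
            }
          ; identity = (λ u i _ → ⊛-identityˡ u i)
                     , (λ u i _ → trans (⊛-comm u 1ˢ i) (⊛-identityˡ u i))
          }
        ; comm = λ u v i _ → ⊛-comm u v i
        }
      ; distribʳ = λ u v w i _ → ⊛-distribʳ u v w i
      ; zeroˡ    = λ v i _ → ⊛-zeroˡ v i
      }
    }
    where
    isEquivalenceˢ : IsEquivalence (λ (u v : Series) → ∀ i → i ≤ N → u i ≈ v i)
    isEquivalenceˢ = record
      { refl  = λ _ _ → refl
      ; sym   = λ u≈v i i≤N → sym (u≈v i i≤N)
      ; trans = λ u≈v v≈w i i≤N → trans (u≈v i i≤N) (v≈w i i≤N)
      }
    ⊛-identityˡ : ∀ u i → (1ˢ ⊛ u) i ≈ u i
    ⊛-identityˡ u i = trans (constant-⊛ 1# u i) (*-identityˡ (u i))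

-- The algebraic identity behind the telescoping.

module WindowIdentity {c ℓ} (R : CommutativeSemiring c ℓ) where
  open CommutativeSemiring R
  open import Relation.Binary.Reasoning.Setoid setoid
  open import Algebra.Solver.Ring.NaturalCoefficients.Default R

  module _ {τ e x y z : Carrier}
    (y≈ : y ≈ x * (1# + (1# + τ) * y)) (z≈ : z ≈ e * x * (1# + (1# + τ) * z)) where

    private t = 1# + τ

    -- Both sides equal `e * x * (1# + t * y) * (1# + t * z)`. In the application `x` is x^p, `e` is
    -- x^i, `y` is h_p and `z` is h_{p+i}.
    exchange : z * (1# + t * y) ≈ e * y * (1# + t * z)
    exchange = begin
      z * (1# + t * y)                              ≈⟨ *-congʳ z≈ ⟩
      e * x * (1# + t * z) * (1# + t * y)
        ≈⟨ solve 5 (λ τ e x y z →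
             e :* x :* (con 1 :+ (con 1 :+ τ) :* z) :* (con 1 :+ (con 1 :+ τ) :* y) :=
             e :* (x :* (con 1 :+ (con 1 :+ τ) :* y)) :* (con 1 :+ (con 1 :+ τ) :* z))
             refl τ e x y z ⟩
      e * (x * (1# + t * y)) * (1# + t * z)         ≈⟨ *-congʳ (*-congˡ y≈) ⟨
      e * y * (1# + t * z)                          ∎

    -- (1 - e) (a z - t f a z) = e (a f′ - f a) for f = 1 + τ y and f′ = 1 + τ z, with both
    -- sides moved so that no subtraction occurs.
    window-step : ∀ a →
      a * z + e * (t * ((1# + τ * y) * a * z)) + e * ((1# + τ * y) * a) ≈
      t * ((1# + τ * y) * a * z) + e * (a * z) + e * (a * (1# + τ * z))
    window-step a = begin
      a * z + e * (t * ((1# + τ * y) * a * z)) + e * ((1# + τ * y) * a)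
        ≈⟨ solve 5 (λ a τ e y z → let t = con 1 :+ τ; f = con 1 :+ τ :* y in
             a :* z :+ e :* (t :* (f :* a :* z)) :+ e :* (f :* a) :=
             a :* (z :+ e :* t :* z :+ e) :+ a :* τ :* (e :* y :* (con 1 :+ t :* z)))
             refl a τ e y z ⟩
      a * (z + e * t * z + e) + a * τ * (e * y * (1# + t * z))
        ≈⟨ +-congˡ (*-congˡ exchange) ⟨
      a * (z + e * t * z + e) + a * τ * (z * (1# + t * y))
        ≈⟨ solve 5 (λ a τ e y z → let t = con 1 :+ τ; f = con 1 :+ τ :* y in
             a :* (z :+ e :* t :* z :+ e) :+ a :* τ :* (z :* (con 1 :+ t :* y)) :=
             t :* (f :* a :* z) :+ e :* (a :* z) :+ e :* (a :* (con 1 :+ τ :* z)))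
             refl a τ e y z ⟩
      t * ((1# + τ * y) * a * z) + e * (a * z) + e * (a * (1# + τ * z))
        ∎

-- The series h, f and Γ modulo x^(N+1), and the telescoping sum.

module Windows {c ℓ} (K : CommutativeSemiring c ℓ)
               (τ : CommutativeSemiring.Carrier K) (N : ℕ) where
  private module K = CommutativeSemiring K
  open PowerSeries K
  private
    R = truncated N
    t = K.1# K.+ τ
  open import Algebra.Properties.Semiring.Exp K.semiring using (_^_)
  open CommutativeSemiring R
  open BigOperators R
  open import Relation.Binary.Reasoning.Setoid setoid
  import Algebra.Solver.Ring.NaturalCoefficients.Default R as Solver
  open WindowIdentity R

  τˢ : Series
  τˢ = monomial τ 0

  x^ : ℕ → Series
  x^ = monomial K.1#

  -- h j = x ^ j / (1 - t x ^ j) and f j = (1 - x ^ j) / (1 - t x ^ j).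
  h f : ℕ → Series
  h j = ∑[ k ∈ upTo N ] monomial (t ^ k) (j ℕ.* suc k)
  f j = 1# + τˢ * h j

  A : ℕ → ℕ → Series
  A p r = ∏ r (λ k → f (suc (p ℕ.+ k)))

  monomial-large : ∀ {y e} → N < e → monomial y e ≈ 0#
  monomial-large N<e i i≤N = K.reflexive (monomial-≢ _ (ℕ.>⇒≢ (ℕ.≤-<-trans i≤N N<e)))

  tˢ≈ : monomial t 0 ≈ 1# + τˢ
  tˢ≈ i _ = monomial-+ K.1# τ 0 i

  x^-+ : ∀ d e → x^ (d ℕ.+ e) ≈ x^ d * x^ e
  x^-+ d e i _ = K.sym (K.trans (monomial-* K.1# K.1# d e i)
    (monomial-cong (d ℕ.+ e) i (K.*-identityˡ K.1#)))

  -- The defining fraction with its denominator cleared. The geometric sum can be extended by the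
  -- term of index `N`, whose exponent `j * suc N` exceeds `N` because `j` is positive; splitting
  -- off the first term of the longer sum then gives the equation.
  h-geometric : ∀ j .{{_ : ℕ.NonZero j}} → h j ≈ x^ j * (1# + (1# + τˢ) * h j)
  h-geometric j = begin
    ∑ (upTo N) φ                             ≈⟨ +-identityʳ _ ⟨
    ∑ (upTo N) φ + 0#                        ≈⟨ +-congˡ (monomial-large (ℕ.m≤n*m (suc N) j)) ⟨
    ∑ (upTo N) φ + φ N                       ≈⟨ ∑-upTo-∷ʳ N φ ⟨
    ∑ (upTo (suc N)) φ                       ≈⟨ ∑-upTo-suc N φ ⟩
    φ 0 + ∑ (upTo N) (φ ∘ suc)
      ≈⟨ +-cong (reflexive (≡.cong x^ (ℕ.*-identityʳ j))) (∑-cong (upTo N) φ-suc) ⟩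
    x^ j + (∑[ k ∈ upTo N ] x^ j * (monomial t 0 * φ k))
      ≈⟨ +-congˡ (*-∑ (x^ j) (upTo N) (λ k → monomial t 0 * φ k)) ⟨
    x^ j + x^ j * (∑[ k ∈ upTo N ] monomial t 0 * φ k)
      ≈⟨ +-congˡ (*-congˡ (*-∑ (monomial t 0) (upTo N) φ)) ⟨
    x^ j + x^ j * (monomial t 0 * h j)       ≈⟨ +-cong (sym (*-identityʳ _)) (*-congˡ (*-congʳ tˢ≈)) ⟩
    x^ j * 1# + x^ j * ((1# + τˢ) * h j)     ≈⟨ distribˡ (x^ j) _ _ ⟨
    x^ j * (1# + (1# + τˢ) * h j)            ∎
    where
    φ : ℕ → Series
    φ k = monomial (t ^ k) (j ℕ.* suc k)

    φ-suc : ∀ k → φ (suc k) ≈ x^ j * (monomial t 0 * φ k)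
    φ-suc k = begin
      monomial (t ^ suc k) (j ℕ.* suc (suc k))
        ≡⟨ ≡.cong (monomial (t ^ suc k)) (ℕ.*-suc j (suc k)) ⟩
      monomial (t ^ suc k) (j ℕ.+ j ℕ.* suc k)
        ≈⟨ (λ i _ → monomial-cong (j ℕ.+ j ℕ.* suc k) i (K.*-identityˡ _)) ⟨
      monomial (K.1# K.* t ^ suc k) (j ℕ.+ j ℕ.* suc k)
        ≈⟨ (λ i _ → monomial-* K.1# (t ^ suc k) j (j ℕ.* suc k) i) ⟨
      x^ j * monomial (t ^ suc k) (j ℕ.* suc k)
        ≈⟨ *-congˡ (λ i _ → monomial-* t (t ^ k) 0 (j ℕ.* suc k) i) ⟨
      x^ j * (monomial t 0 * φ k)
        ∎

  h-large : ∀ {j} → N < j → h j ≈ 0#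
  h-large {j} N<j = ∑-zero (upTo N) λ {k} _ →
    monomial-large (ℕ.<-≤-trans N<j (ℕ.m≤m*n j (suc k)))

  f-large : ∀ {j} → N < j → f j ≈ 1#
  f-large N<j = trans (+-congˡ (trans (*-congˡ (h-large N<j)) (zeroʳ τˢ))) (+-identityʳ 1#)

  A-suc : ∀ p r → A p (suc r) ≈ f (suc p) * A (suc p) r
  A-suc p r = *-cong (reflexive (≡.cong (f ∘ suc) (ℕ.+-identityʳ p)))
    (∏-cong r (λ k _ → reflexive (≡.cong (f ∘ suc) (ℕ.+-suc p k))))

  A-∷ʳ : ∀ p r → A p (suc r) ≈ A p r * f (suc (p ℕ.+ r))
  A-∷ʳ p r = begin
    A p (suc r)                                      ≡⟨ ≡.cong (A p) (ℕ.+-comm r 1) ⟨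
    A p (r ℕ.+ 1)                                    ≈⟨ ∏-+ r 1 (λ k → f (suc (p ℕ.+ k))) ⟩
    A p r * (f (suc (p ℕ.+ (r ℕ.+ 0))) * 1#)         ≈⟨ *-congˡ (*-identityʳ _) ⟩
    A p r * f (suc (p ℕ.+ (r ℕ.+ 0)))
      ≡⟨ ≡.cong (λ k → A p r * f (suc (p ℕ.+ k))) (ℕ.+-identityʳ r) ⟩
    A p r * f (suc (p ℕ.+ r))                        ∎

  -- The generating function of the partitions with largest part suc (p + r) and smallest
  -- part > p.
  G : ℕ → ℕ → Series
  G r p = A p r * h (suc (p ℕ.+ r))

  -- A partial sum of Γ_{r+1}. Modulo x^(N+1) it no longer changes from `P = N` on.
  S : ℕ → ℕ → Series
  S r P = ∑ (upTo P) (G r)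

  -- With subtraction this reads (1 - e) (S r (P+1) - t S (r+1) P) = e A P (r+1). The first sum is
  -- one term longer because `G r (suc p)` is paired with `G (suc r) p`: both have the largest part
  -- p + r + 2, and the latter only has the additional factor f_{p+1}. The term `G r 0` without a
  -- partner starts the induction.
  telescope : ∀ r P → let e = x^ (suc r) in
    S r (suc P) + e * ((1# + τˢ) * S (suc r) P) ≈
    (1# + τˢ) * S (suc r) P + e * S r (suc P) + e * A P (suc r)
  telescope r zero = begin
    -- The second sum is empty, so the claim is the geometric equation of `h (suc r)` multiplied by
    -- `a`.
    S r 1 + e * ((1# + τˢ) * 0#)              ≈⟨ +-congʳ (+-congʳ (*-congˡ (h-geometric (suc r)))) ⟩
    a * (e * (1# + (1# + τˢ) * z)) + 0# + e * ((1# + τˢ) * 0#)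
      ≈⟨ solve 4 (λ a τ e z →
           a :* (e :* (con 1 :+ (con 1 :+ τ) :* z)) :+ con 0 :+ e :* ((con 1 :+ τ) :* con 0) :=
           (con 1 :+ τ) :* con 0 :+ e :* (a :* z :+ con 0) :+ e :* (a :* (con 1 :+ τ :* z)))
           refl a τˢ e z ⟩
    (1# + τˢ) * 0# + e * S r 1 + e * (a * f (suc r))     ≈⟨ +-congˡ (*-congˡ (A-∷ʳ 0 r)) ⟨
    (1# + τˢ) * 0# + e * S r 1 + e * A 0 (suc r)         ∎
    where
    open Solver
    e = x^ (suc r)
    a = A 0 r
    z = h (suc r)
  telescope r (suc P) = begin
    S r (suc (suc P)) + e * (t̂ * S (suc r) (suc P))
      ≈⟨ +-cong (∑-upTo-∷ʳ (suc P) (G r)) (*-congˡ (*-congˡ S-suc)) ⟩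
    s + g + e * (t̂ * (s′ + g′))
      ≈⟨ solve 6 (λ s g e t s′ g′ → s :+ g :+ e :* (t :* (s′ :+ g′)) :=
           s :+ e :* (t :* s′) :+ (g :+ e :* (t :* g′))) refl s g e t̂ s′ g′ ⟩
    s + e * (t̂ * s′) + (g + e * (t̂ * g′))            ≈⟨ +-congʳ (telescope r P) ⟩
    t̂ * s′ + e * s + e * A P (suc r) + (g + e * (t̂ * g′))
      ≈⟨ +-congʳ (+-congˡ (*-congˡ (A-suc P r))) ⟩
    t̂ * s′ + e * s + e * (f (suc P) * a) + (g + e * (t̂ * g′))
      ≈⟨ solve 7 (λ s g e t s′ g′ b → t :* s′ :+ e :* s :+ e :* b :+ (g :+ e :* (t :* g′)) :=
           t :* s′ :+ e :* s :+ (g :+ e :* (t :* g′) :+ e :* b))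
           refl s g e t̂ s′ g′ (f (suc P) * a) ⟩
    t̂ * s′ + e * s + (g + e * (t̂ * g′) + e * (f (suc P) * a))
      -- The new pair `g`, `g′` changes the boundary term from `e * A P (suc r)` to
      -- `e * A (suc P) (suc r)`: these products share `a` and differ only in their outermost
      -- factors.
      ≈⟨ +-congˡ (window-step (h-geometric (suc P)) z≈ a) ⟩
    t̂ * s′ + e * s + (t̂ * g′ + e * g + e * (a * f (suc (suc P ℕ.+ r))))
      ≈⟨ solve 7 (λ s g e t s′ g′ c →
           t :* s′ :+ e :* s :+ (t :* g′ :+ e :* g :+ e :* c) :=
           t :* (s′ :+ g′) :+ e :* (s :+ g) :+ e :* c)
           refl s g e t̂ s′ g′ (a * f (suc (suc P ℕ.+ r))) ⟩
    t̂ * (s′ + g′) + e * (s + g) + e * (a * f (suc (suc P ℕ.+ r)))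
      ≈⟨ +-cong (+-cong (*-congˡ S-suc) (*-congˡ (∑-upTo-∷ʳ (suc P) (G r))))
                (*-congˡ (A-∷ʳ (suc P) r)) ⟨
    t̂ * S (suc r) (suc P) + e * S r (suc (suc P)) + e * A (suc P) (suc r) ∎
    where
    open Solver
    t̂ = 1# + τˢ
    e = x^ (suc r)
    a = A (suc P) r
    z = h (suc (suc P ℕ.+ r))
    s = S r (suc P)
    s′ = S (suc r) P
    g = a * z
    g′ = f (suc P) * a * z
    z≈ : z ≈ e * x^ (suc P) * (1# + t̂ * z)
    z≈ = begin
      z                                       ≈⟨ h-geometric (suc (suc P ℕ.+ r)) ⟩
      x^ (suc (suc P ℕ.+ r)) * (1# + t̂ * z)
        ≡⟨ ≡.cong (λ k → x^ (suc k) * (1# + t̂ * z)) (ℕ.+-comm (suc P) r) ⟩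
      x^ (suc r ℕ.+ suc P) * (1# + t̂ * z)     ≈⟨ *-congʳ (x^-+ (suc r) (suc P)) ⟩
      e * x^ (suc P) * (1# + t̂ * z)           ∎
    S-suc : S (suc r) (suc P) ≈ s′ + g′
    S-suc = trans (∑-upTo-∷ʳ P (G (suc r)))
      (+-congˡ (*-cong (A-suc P r) (reflexive (≡.cong (h ∘ suc) (ℕ.+-suc P r)))))

  -- At `P = N` the truncation supplies the limit of `telescope`: the term `G r N` vanishes, and
  -- `A N (suc r)` is 1 because all its factors have index above `N`.
  S-recurrence : ∀ r → let e = x^ (suc r) in
    S r N + e * ((1# + τˢ) * S (suc r) N) ≈ (1# + τˢ) * S (suc r) N + e * S r N + e
  S-recurrence r = begin
    S r N + e * ((1# + τˢ) * S (suc r) N)            ≈⟨ +-congʳ S-stable ⟨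
    S r (suc N) + e * ((1# + τˢ) * S (suc r) N)      ≈⟨ telescope r N ⟩
    (1# + τˢ) * S (suc r) N + e * S r (suc N) + e * A N (suc r)
      ≈⟨ +-cong (+-congˡ (*-congˡ S-stable)) (*-congˡ A≈1) ⟩
    (1# + τˢ) * S (suc r) N + e * S r N + e * 1#     ≈⟨ +-congˡ (*-identityʳ e) ⟩
    (1# + τˢ) * S (suc r) N + e * S r N + e          ∎
    where
    e = x^ (suc r)
    S-stable : S r (suc N) ≈ S r N
    S-stable = begin
      S r (suc N)                         ≈⟨ ∑-upTo-∷ʳ N (G r) ⟩
      S r N + A N r * h (suc (N ℕ.+ r))   ≈⟨ +-congˡ (*-congˡ (h-large (s≤s (ℕ.m≤m+n N r)))) ⟩
      S r N + A N r * 0#                  ≈⟨ +-congˡ (zeroʳ (A N r)) ⟩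
      S r N + 0#                          ≈⟨ +-identityʳ _ ⟩
      S r N                               ∎
    A≈1 : A N (suc r) ≈ 1#
    A≈1 = ∏-one (suc r) (λ k _ → f-large (s≤s (ℕ.m≤m+n N k)))

-- Weighted partitions in a window as coefficients of a product.

module Counting {c ℓ} (K : CommutativeSemiring c ℓ)
                (τ : CommutativeSemiring.Carrier K) (N : ℕ) where
  private module K where
    open CommutativeSemiring K public
    open BigOperators K public
  open PowerSeries K
  open Windows K τ N
  private
    R = truncated N
    t = K.1# K.+ τ
  open import Algebra.Properties.Semiring.Exp K.semiring using (_^_)
  open CommutativeSemiring R
  open BigOperators R
  open import Relation.Binary.Reasoning.Setoid setoid
  open import Algebra.Properties.CommutativeSemigroup *-commutativeSemigroup using (x∙yz≈y∙xz)

  ∑-coefficient : ∀ {b} {B : Set b} xs (u : B → Series) {i} →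
                  ∑ xs u i K.≈ (K.∑[ x ∈ xs ] u x i)
  ∑-coefficient []       u = K.refl
  ∑-coefficient (x ∷ xs) u = K.+-congˡ (∑-coefficient xs u)

  -- w j k is the weight of the multiplicity k of the part suc j.
  weigh : ∀ {m} → (ℕ → ℕ → K.Carrier) → Vec ℕ m → K.Carrier
  weigh w []      = K.1#
  weigh w (k ∷ v) = w 0 k K.* weigh (w ∘ suc) v

  -- Expanding the product chooses one multiplicity for each index. The weights `w` and the part
  -- sizes `g` are arbitrary so that the induction can shift both by one when the head of the vector
  -- is removed.
  ∑-boundedVecs : ∀ b m (w : ℕ → ℕ → K.Carrier) (g : ℕ → ℕ) →
    ∑[ v ∈ boundedVecs b m ]
      monomial (weigh w v) (Vec.sum (tabulate λ i → g (toℕ i) ℕ.* lookup v i)) ≈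
    ∏ m (λ j → ∑[ k ∈ upTo (suc b) ] monomial (w j k) (g j ℕ.* k))
  ∑-boundedVecs b zero    w g = +-identityʳ 1#
  ∑-boundedVecs b (suc m) w g = begin
    ∑ (boundedVecs b (suc m)) ψ
      ≈⟨ ∑-cartesianProductWith _∷_ (upTo (suc b)) (boundedVecs b m) ψ ⟩
    (∑[ k ∈ upTo (suc b) ] ∑[ v ∈ boundedVecs b m ] ψ (k ∷ v))
      ≈⟨ ∑-cong (upTo (suc b)) (λ k → trans
           (∑-cong (boundedVecs b m) λ v i _ → K.sym (monomial-* (w 0 k) _ (g 0 ℕ.* k) _ i))
           (sym (*-∑ (monomial (w 0 k) (g 0 ℕ.* k)) (boundedVecs b m) ψ′))) ⟩
    (∑[ k ∈ upTo (suc b) ] monomial (w 0 k) (g 0 ℕ.* k) * ∑ (boundedVecs b m) ψ′)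
      ≈⟨ ∑-* (∑ (boundedVecs b m) ψ′) (upTo (suc b)) _ ⟨
    (∑[ k ∈ upTo (suc b) ] monomial (w 0 k) (g 0 ℕ.* k)) * ∑ (boundedVecs b m) ψ′
      ≈⟨ *-congˡ {∑[ k ∈ upTo (suc b) ] monomial (w 0 k) (g 0 ℕ.* k)}
           (∑-boundedVecs b m (w ∘ suc) (g ∘ suc)) ⟩
    ∏ (suc m) (λ j → ∑[ k ∈ upTo (suc b) ] monomial (w j k) (g j ℕ.* k)) ∎
    where
    ψ : Vec ℕ (suc m) → Series
    ψ v = monomial (weigh w v) (Vec.sum (tabulate λ i → g (toℕ i) ℕ.* lookup v i))
    ψ′ : Vec ℕ m → Series
    ψ′ v = monomial (weigh (w ∘ suc) v) (Vec.sum (tabulate λ i → g (suc (toℕ i)) ℕ.* lookup v i))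

  -- free k = t ^ k * q for k > 0, where t * q = τ.
  free : ℕ → K.Carrier
  free zero    = K.1#
  free (suc k) = t ^ k K.* τ

  -- The part suc j is barred if j < p or j > p + r, and required if j = p + r.
  window : ℕ → ℕ → ℕ → ℕ → K.Carrier
  window p r j zero    = if does (j ℕ.≟ p ℕ.+ r) then K.0# else K.1#
  window p r j (suc k) =
    if does ((p ℕ.≤? j) ×-dec (j ℕ.≤? p ℕ.+ r)) then free (suc k) else K.0#

  factor : ℕ → ℕ → ℕ → Series
  factor p r j = ∑[ k ∈ upTo (suc N) ] monomial (window p r j k) (suc j ℕ.* k)

  module _ (p r : ℕ) where

    private
      tail : ℕ → Series
      tail j = ∑[ k ∈ upTo N ] monomial (window p r j (suc k)) (suc j ℕ.* suc k)

      factor-split : ∀ j → factor p r j ≈ monomial (window p r j 0) 0 + tail j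
      factor-split j = trans (∑-upTo-suc N _)
        (+-congʳ (reflexive (≡.cong (monomial _) (ℕ.*-zeroʳ j))))

      tail-inside : ∀ {j} → p ≤ j → j ≤ p ℕ.+ r → tail j ≈ τˢ * h (suc j)
      tail-inside {j} p≤j j≤p+r = begin
        tail j
          ≈⟨ ∑-cong (upTo N) (λ k i _ → K.trans
               (K.reflexive (≡.cong (λ x → monomial x (suc j ℕ.* suc k) i)
                 (if-yes ((p ℕ.≤? j) ×-dec (j ℕ.≤? p ℕ.+ r)) (p≤j , j≤p+r))))
               (K.trans (monomial-cong (suc j ℕ.* suc k) i (K.*-comm _ τ))
                        (K.sym (monomial-* τ (t ^ k) 0 (suc j ℕ.* suc k) i)))) ⟩
        (∑[ k ∈ upTo N ] τˢ * monomial (t ^ k) (suc j ℕ.* suc k))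
          ≈⟨ *-∑ τˢ (upTo N) _ ⟨
        τˢ * h (suc j) ∎

      tail-outside : ∀ {j} → ¬ (p ≤ j × j ≤ p ℕ.+ r) → tail j ≈ 0#
      tail-outside {j} j∉ = ∑-zero (upTo N) (λ {k} _ i _ → K.trans
        (K.reflexive (≡.cong (λ x → monomial x (suc j ℕ.* suc k) i)
          (if-no ((p ℕ.≤? j) ×-dec (j ℕ.≤? p ℕ.+ r)) j∉)))
        (monomial-zero (suc j ℕ.* suc k) i))

      head-≡ : ∀ {j} → j ≡ p ℕ.+ r → monomial (window p r j 0) 0 ≈ 0#
      head-≡ {j} eq i _ = K.trans
        (K.reflexive (≡.cong (λ x → monomial x 0 i) (if-yes (j ℕ.≟ p ℕ.+ r) eq)))
        (monomial-zero 0 i)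

      head-≢ : ∀ {j} → j ≢ p ℕ.+ r → monomial (window p r j 0) 0 ≈ 1#
      head-≢ {j} neq i _ =
        K.reflexive (≡.cong (λ x → monomial x 0 i) (if-no (j ℕ.≟ p ℕ.+ r) neq))

    factor-inside : ∀ {j} → p ≤ j → j < p ℕ.+ r → factor p r j ≈ f (suc j)
    factor-inside {j} p≤j j<p+r = trans (factor-split j)
      (+-cong (head-≢ (ℕ.<⇒≢ j<p+r)) (tail-inside p≤j (ℕ.<⇒≤ j<p+r)))

    factor-top : ∀ {j} → j ≡ p ℕ.+ r → factor p r j ≈ τˢ * h (suc j)
    factor-top {j} ≡.refl = trans (factor-split j)
      (trans (+-cong (head-≡ ≡.refl) (tail-inside (ℕ.m≤m+n p r) ℕ.≤-refl)) (+-identityˡ _))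

    factor-below : ∀ {j} → j < p → factor p r j ≈ 1#
    factor-below {j} j<p = trans (factor-split j)
      (trans (+-cong (head-≢ (ℕ.<⇒≢ (ℕ.<-≤-trans j<p (ℕ.m≤m+n p r))))
                     (tail-outside λ (p≤j , _) → ℕ.<⇒≱ j<p p≤j))
             (+-identityʳ 1#))

    factor-above : ∀ {j} → p ℕ.+ r < j → factor p r j ≈ 1#
    factor-above {j} p+r<j = trans (factor-split j)
      (trans (+-cong (head-≢ (ℕ.>⇒≢ p+r<j)) (tail-outside λ (_ , j≤) → ℕ.<⇒≱ p+r<j j≤))
             (+-identityʳ 1#))

    -- Parts outside the window must be absent and contribute 1, and the `r` parts below the top
    -- contribute their `f`. The top part has no term for multiplicity 0, so it contributes τ h in
    -- place of 1 + τ h; this is the origin of the factor `τˢ`.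
    ∏-factor : p ℕ.+ r < N → ∏ N (factor p r) ≈ τˢ * G r p
    ∏-factor p+r<N = begin
      ∏ N (factor p r)
        ≡⟨ ≡.cong (λ m → ∏ m (factor p r)) N≡ ⟩
      ∏ (p ℕ.+ (r ℕ.+ suc q)) (factor p r)
        ≈⟨ trans (∏-+ p (r ℕ.+ suc q) (factor p r))
             (*-congˡ (∏-+ r (suc q) (λ k → factor p r (p ℕ.+ k)))) ⟩
      ∏ p (factor p r) * (∏ r (λ k → factor p r (p ℕ.+ k)) *
        (factor p r (p ℕ.+ (r ℕ.+ 0)) * ∏ q (λ k → factor p r (p ℕ.+ (r ℕ.+ suc k)))))
        ≈⟨ *-cong (∏-one p (λ _ → factor-below))
             (*-cong (∏-cong r (λ k k<r → factor-inside (ℕ.m≤m+n p k) (ℕ.+-monoʳ-< p k<r)))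
               (*-cong (factor-top (≡.cong (p ℕ.+_) (ℕ.+-identityʳ r)))
                 (∏-one q (λ k _ → factor-above (ℕ.+-monoʳ-< p (ℕ.m<m+n r (s≤s z≤n))))))) ⟩
      1# * (A p r * (τˢ * h (suc (p ℕ.+ (r ℕ.+ 0))) * 1#))
        ≈⟨ trans (*-identityˡ _) (*-congˡ (*-identityʳ _)) ⟩
      A p r * (τˢ * h (suc (p ℕ.+ (r ℕ.+ 0))))
        ≡⟨ ≡.cong (λ k → A p r * (τˢ * h (suc (p ℕ.+ k)))) (ℕ.+-identityʳ r) ⟩
      A p r * (τˢ * h (suc (p ℕ.+ r)))
        ≈⟨ x∙yz≈y∙xz (A p r) τˢ _ ⟩
      τˢ * G r p ∎
      where
      q = N ∸ suc (p ℕ.+ r)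
      N≡ : N ≡ p ℕ.+ (r ℕ.+ suc q)
      N≡ = ≡.trans (≡.sym (ℕ.m+[n∸m]≡n p+r<N))
        (≡.trans (≡.sym (ℕ.+-suc (p ℕ.+ r) q)) (ℕ.+-assoc p r (suc q)))

    -- Selecting the vectors of weight `N` amounts to reading off the coefficient of x^N in the
    -- product of all `factor p r j`. The bound `N` on multiplicities matches the number of terms in
    -- `h`.
    ∑-window : p ℕ.+ r < N →
               (K.∑[ π ∈ P N ] weigh (window p r) π) K.≈ τ K.* G r p N
    ∑-window p+r<N = K.trans (K.∑-filter (λ π → weight π ℕ.≟ N) (boundedVecs N N) _)
      (K.trans (K.∑-cong (boundedVecs N N) (λ π → coefficient _ (weight π ℕ.≟ N)))
      (K.trans (K.sym (∑-coefficient (boundedVecs N N) _))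
      (K.trans (∑-boundedVecs N N (window p r) suc N ℕ.≤-refl)
      (K.trans (∏-factor p+r<N N ℕ.≤-refl)
               (constant-⊛ τ (G r p) N)))))
      where
      coefficient : ∀ x {e} (e≟N : Dec (e ≡ N)) →
                    (if does e≟N then x else K.0#) K.≈ monomial x e N
      coefficient x (yes ≡.refl) = K.reflexive (≡.sym (monomial-≡ x N))
      coefficient x (no e≢N)     = K.reflexive (≡.sym (monomial-≢ x e≢N))

    G-large : N ≤ p ℕ.+ r → G r p ≈ 0#
    G-large N≤p+r = trans (*-congˡ (h-large (s≤s N≤p+r))) (zeroʳ (A p r))

-- Solving the recurrence: divisor indicators as coefficients.

module Divisibility {c ℓ} (K : CommutativeRing c ℓ)
                    (τ : CommutativeRing.Carrier K) (N : ℕ) where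
  open CommutativeRing K
  open PowerSeries commutativeSemiring
  private module R = CommutativeSemiring (truncated N)
  open Windows commutativeSemiring τ N
  open import Relation.Binary.Reasoning.Setoid setoid
  open import Algebra.Properties.Group +-group using (∙-cancelʳ)
  open import Algebra.Solver.Ring.NaturalCoefficients.Default commutativeSemiring

  private
    t = 1# + τ

    t-coefficient : ∀ u {i} → i ≤ N → ((1ˢ ⊕ τˢ) ⊛ u) i ≈ t * u i
    t-coefficient u {i} i≤N =
      trans (R.*-congʳ {u} (R.sym tˢ≈) i i≤N) (constant-⊛ t u i)

  -- The coefficient of x^m in x^d + x^(2d) + ⋯ . The value at 0 departs from divisibility because
  -- this series has no constant term.
  [_∣_] : ℕ → ℕ → Carrier
  [ d ∣ zero  ] = 0#
  [ d ∣ suc m ] = if does (d ∣? suc m) then 1# else 0#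

  [∣]-< : ∀ {d m} → m < d → [ d ∣ m ] ≈ 0#
  [∣]-< {d} {zero}  m<d = refl
  [∣]-< {d} {suc m} m<d = reflexive (if-no (d ∣? suc m) (λ d∣m → ℕ.<⇒≱ m<d (∣⇒≤ d∣m)))

  -- The equation D = x^d (1 + D) for this series, read coefficientwise. The summand `1ˢ k` accounts
  -- for d dividing itself, which the value 0 at `k = 0` would miss.
  [∣]-+ : ∀ r k → [ suc r ∣ suc r ℕ.+ k ] ≈ [ suc r ∣ k ] + 1ˢ k
  [∣]-+ r zero = trans (reflexive (if-yes (suc r ∣? suc r ℕ.+ 0)
    (≡.subst (suc r ∣_) (≡.sym (ℕ.+-identityʳ (suc r))) ∣-refl)))
    (sym (+-identityˡ 1#))
  [∣]-+ r (suc k) = trans (reflexive (≡.cong (if_then 1# else 0#)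
    (does-⇔ (mk⇔ (λ d∣ → ∣m+n∣m⇒∣n d∣ ∣-refl) (∣m∣n⇒∣m+n ∣-refl))
            (suc r ∣? suc r ℕ.+ suc k) (suc r ∣? suc k))))
    (sym (+-identityʳ _))

  -- By `S-recurrence`, D = S r N - t S (r+1) N satisfies D = e (D + 1) with e = x^(r+1). This fixes
  -- the coefficients of D below r + 1 and ties each later one to the one r + 1 places earlier,
  -- hence the strong induction.
  S-divisor : ∀ r m → m ≤ N → S r N m ≈ t * S (suc r) N m + [ suc r ∣ m ]
  S-divisor r = <-rec _ step
    where
    s s′ : ℕ → Carrier
    s  = S r N
    s′ = S (suc r) N
    e = x^ (suc r)
    Goal : ℕ → Set ℓ
    Goal m = m ≤ N → s m ≈ t * s′ m + [ suc r ∣ m ]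

    recurrence : ∀ {m} → m ≤ N →
      s m + (e ⊛ ((1ˢ ⊕ τˢ) ⊛ s′)) m ≈ t * s′ m + (e ⊛ s) m + e m
    recurrence m≤N = trans (S-recurrence r _ m≤N)
      (+-congʳ (+-congʳ (t-coefficient s′ m≤N)))

    at-+ : ∀ u k → (e ⊛ u) (suc r ℕ.+ k) ≈ u k
    at-+ u k = trans (monomial-⊛-≥ 1# (suc r) u k) (*-identityˡ (u k))

    e-+ : ∀ d k → monomial 1# d (d ℕ.+ k) ≈ 1ˢ k
    e-+ zero    k = refl
    e-+ (suc d) k = e-+ d k

    step : ∀ m → (∀ {k} → k < m → Goal k) → Goal m
    step m rec m≤N with m ℕ.<? suc r
    ... | yes m<d = begin
      s m                                            ≈⟨ +-identityʳ _ ⟨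
      s m + 0#                                       ≈⟨ +-congˡ (monomial-⊛-< 1# _ m<d) ⟨
      s m + (e ⊛ ((1ˢ ⊕ τˢ) ⊛ s′)) m                 ≈⟨ recurrence m≤N ⟩
      t * s′ m + (e ⊛ s) m + e m
        ≈⟨ +-cong (+-congˡ (monomial-⊛-< 1# _ m<d)) (reflexive (monomial-≢ 1# (ℕ.>⇒≢ m<d))) ⟩
      t * s′ m + 0# + 0#                             ≈⟨ +-identityʳ _ ⟩
      t * s′ m + 0#                                  ≈⟨ +-congˡ ([∣]-< m<d) ⟨
      t * s′ m + [ suc r ∣ m ]                       ∎
    ... | no m≮d with ℕ.m≤n⇒∃[o]m+o≡n (ℕ.≮⇒≥ m≮d)
    -- Here m = suc r + k. The shifted term `t * s′ k` arises on the left from the recurrence and on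
    -- the right from the induction hypothesis for `k`; removing it requires additive cancellation,
    -- hence a ring.
    ... | k , ≡.refl = ∙-cancelʳ (t * s′ k) _ _ (begin
      s m + t * s′ k
        ≈⟨ +-congˡ (trans (at-+ _ k) (t-coefficient s′ k≤N)) ⟨
      s m + (e ⊛ ((1ˢ ⊕ τˢ) ⊛ s′)) m                 ≈⟨ recurrence m≤N ⟩
      t * s′ m + (e ⊛ s) m + e m                     ≈⟨ +-cong (+-congˡ (at-+ s k)) (e-+ (suc r) k) ⟩
      t * s′ m + s k + 1ˢ k                          ≈⟨ +-congʳ (+-congˡ (rec (ℕ.m<n+m k (s≤s z≤n)) k≤N)) ⟩
      t * s′ m + (t * s′ k + [ suc r ∣ k ]) + 1ˢ k
        ≈⟨ solve 4 (λ a b c d → a :+ (b :+ c) :+ d := a :+ (c :+ d) :+ b) refl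
             (t * s′ m) (t * s′ k) [ suc r ∣ k ] (1ˢ k) ⟩
      t * s′ m + ([ suc r ∣ k ] + 1ˢ k) + t * s′ k   ≈⟨ +-congʳ (+-congˡ ([∣]-+ r k)) ⟨
      t * s′ m + [ suc r ∣ m ] + t * s′ k            ∎)
      where
      k≤N : k ≤ N
      k≤N = ℕ.≤-trans (ℕ.m≤n+m k (suc r)) m≤N

-- Multiplicities, number of distinct parts, smallest and largest part.

sum-tabulate-positive : ∀ {m} (f : Fin m → ℕ) → 0 < Vec.sum (tabulate f) → ∃[ i ] 0 < f i
sum-tabulate-positive {suc m} f 0<sum with f zero in eq
... | suc k = zero , ≡.subst (0 <_) (≡.sym eq) (s≤s z≤n)
... | zero with i , 0<fi ← sum-tabulate-positive (f ∘ suc) 0<sum = suc i , 0<fi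

weight-positive : ∀ {m} (π : Vec ℕ m) → 0 < weight π → ∃[ i ] 0 < lookup π i
weight-positive π 0<w with sum-tabulate-positive (λ i → part i ℕ.* lookup π i) 0<w
... | i , 0<p with lookup π i in eq
... | suc k = i , ≡.subst (0 <_) (≡.sym eq) (s≤s z≤n)
... | zero  = contradiction (≡.subst (0 <_) (ℕ.*-zeroʳ (part i)) 0<p) λ ()

lookup≤sum : ∀ {m} (v : Vec ℕ m) i → lookup v i ≤ Vec.sum v
lookup≤sum (x ∷ v) zero    = ℕ.m≤m+n x _
lookup≤sum (x ∷ v) (suc i) = ℕ.≤-trans (lookup≤sum v i) (ℕ.m≤n+m _ x)

length-filter-map : ∀ {a b p} {A : Set a} {B : Set b} {P : B → Set p} (P? : Decidable P)
                    (f : A → B) xs →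
                    length (filter P? (List.map f xs)) ≡ length (filter (P? ∘ f) xs)
length-filter-map P? f []       = ≡.refl
length-filter-map P? f (x ∷ xs) with does (P? (f x))
... | true  = ≡.cong suc (length-filter-map P? f xs)
... | false = length-filter-map P? f xs

positive : ∀ {m} (v : Vec ℕ m) → Decidable (λ i → 0 < lookup v i)
positive v i = 0 ℕ.<? lookup v i

-- Prepending a multiplicity raises every part stored in `v` by one, so `parts` itself does not
-- simply extend. The length is insensitive to this shift and is computed on indices instead.
#distinctParts-∷ : ∀ {m} k (v : Vec ℕ m) →
  #distinctParts (k ∷ v) ≡ (if does (0 ℕ.<? k) then 1 else 0) ℕ.+ #distinctParts v
#distinctParts-∷ {m} k v = begin
  #distinctParts (k ∷ v)
    ≡⟨ length-map part (filter (positive (k ∷ v)) (allFin (suc m))) ⟩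
  length (filter (positive (k ∷ v)) (allFin (suc m)))
    ≡⟨ head k ⟩
  (if does (0 ℕ.<? k) then 1 else 0) ℕ.+ length (filter (positive (k ∷ v)) (List.tabulate suc))
    ≡⟨ ≡.cong (λ is → _ ℕ.+ length (filter (positive (k ∷ v)) is)) (map-tabulate id suc) ⟨
  (if does (0 ℕ.<? k) then 1 else 0) ℕ.+ length (filter (positive (k ∷ v)) (List.map suc (allFin m)))
    ≡⟨ ≡.cong (_ ℕ.+_) (length-filter-map (positive (k ∷ v)) suc (allFin m)) ⟩
  (if does (0 ℕ.<? k) then 1 else 0) ℕ.+ length (filter (positive v) (allFin m))
    ≡⟨ ≡.cong (_ ℕ.+_) (length-map part (filter (positive v) (allFin m))) ⟨
  (if does (0 ℕ.<? k) then 1 else 0) ℕ.+ #distinctParts v ∎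
  where
  open ≡.≡-Reasoning
  head : ∀ k → length (filter (positive (k ∷ v)) (allFin (suc m))) ≡
    (if does (0 ℕ.<? k) then 1 else 0) ℕ.+ length (filter (positive (k ∷ v)) (List.tabulate suc))
  head zero    = ≡.refl
  head (suc k) = ≡.refl

module _ {m : ℕ} (π : Vec ℕ m) where

  ∈-parts⁺ : ∀ {i} → 0 < lookup π i → part i ∈ parts π
  ∈-parts⁺ {i} 0<πi = ∈-map⁺ part (∈-filter⁺ (λ i → 0 ℕ.<? lookup π i) (∈-allFin i) 0<πi)

  ∈-parts⁻ : ∀ {j} → j ∈ parts π → ∃[ i ] j ≡ part i × 0 < lookup π i
  ∈-parts⁻ j∈ with i , i∈ , eq ← ∈-map⁻ part j∈ =
    i , eq , proj₂ (∈-filter⁻ (λ i → 0 ℕ.<? lookup π i) {xs = allFin m} i∈)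

  smallestPart≤ : ∀ {i} → 0 < lookup π i → smallestPart π ≤ part i
  smallestPart≤ 0<πi = All.lookup (min≤xs m (parts π)) (∈-parts⁺ 0<πi)

  ≤largestPart : ∀ {i} → 0 < lookup π i → part i ≤ largestPart π
  ≤largestPart 0<πi = All.lookup (xs≤max 0 (parts π)) (∈-parts⁺ 0<πi)

  largestPart≤ : largestPart π ≤ m
  largestPart≤ = max≤v⁺ z≤n (All.tabulate λ j∈ → ≤m (∈-parts⁻ j∈))
    where
    ≤m : ∀ {j} → ∃[ i ] j ≡ part i × 0 < lookup π i → j ≤ m
    ≤m (i , ≡.refl , _) = Fin.toℕ<n i

  module _ {i₀} (0<πi₀ : 0 < lookup π i₀) where

    smallestPart-attained : ∃[ i ] smallestPart π ≡ part i × 0 < lookup π i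
    smallestPart-attained with argmin-sel id m (parts π)
    ... | inj₂ s∈ = ∈-parts⁻ s∈
    -- If `min` returns its default `m`, then `part i₀` lies between the smallest part and `m`, so
    -- `i₀` itself is a witness.
    ... | inj₁ s≡m = i₀ , ℕ.≤-antisym (smallestPart≤ 0<πi₀)
      (≡.subst (part i₀ ≤_) (≡.sym s≡m) (Fin.toℕ<n i₀)) , 0<πi₀

    largestPart-attained : ∃[ i ] largestPart π ≡ part i × 0 < lookup π i
    largestPart-attained with argmax-sel id 0 (parts π)
    ... | inj₂ l∈ = ∈-parts⁻ l∈
    ... | inj₁ l≡0 = contradiction (≡.subst (part i₀ ≤_) l≡0 (≤largestPart 0<πi₀)) λ ()

    smallestPart≤largestPart : smallestPart π ≤ largestPart π
    smallestPart≤largestPart = ℕ.≤-trans (smallestPart≤ 0<πi₀) (≤largestPart 0<πi₀)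

    #parts-positive : 0 < #parts π
    #parts-positive = ℕ.≤-trans 0<πi₀ (lookup≤sum π i₀)

    #distinctParts-positive : 0 < #distinctParts π
    #distinctParts-positive = ∈-length (∈-parts⁺ 0<πi₀)

-- The window weight of a single partition.

module Pointwise {c ℓ} (K : CommutativeSemiring c ℓ)
                 (τ : CommutativeSemiring.Carrier K) (N : ℕ) where
  open CommutativeSemiring K hiding (zero)
  open Counting K τ N
  open import Relation.Binary.Reasoning.Setoid setoid
  open import Algebra.Properties.CommutativeSemiring.Exp K
  open import Algebra.Properties.CommutativeSemigroup *-commutativeSemigroup using (interchange)

  private
    t = 1# + τ

  weigh-cong : ∀ {m w w′} (v : Vec ℕ m) →
               (∀ i → w (toℕ i) (lookup v i) ≈ w′ (toℕ i) (lookup v i)) → weigh w v ≈ weigh w′ v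
  weigh-cong []      w≈ = refl
  weigh-cong (k ∷ v) w≈ = *-cong (w≈ zero) (weigh-cong v (w≈ ∘ suc))

  weigh-zero : ∀ {m w} (v : Vec ℕ m) i → w (toℕ i) (lookup v i) ≈ 0# → weigh w v ≈ 0#
  weigh-zero (k ∷ v) zero    w≈0 = trans (*-congʳ w≈0) (zeroˡ _)
  weigh-zero (k ∷ v) (suc i) w≈0 = trans (*-congˡ (weigh-zero v i w≈0)) (zeroʳ _)

  -- A part of multiplicity k + 1 contributes t^k τ = t^(k+1) q, so every distinct part carries
  -- exactly one factor `q`.
  weigh-free : ∀ {q} → t * q ≈ τ → ∀ {m} (v : Vec ℕ m) →
               weigh (λ _ → free) v ≈ t ^ #parts v * q ^ #distinctParts v
  weigh-free tq≈τ []          = sym (*-identityˡ 1#)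
  weigh-free {q} tq≈τ (zero ∷ v)  = begin
    1# * weigh (λ _ → free) v                  ≈⟨ *-identityˡ _ ⟩
    weigh (λ _ → free) v                       ≈⟨ weigh-free tq≈τ v ⟩
    t ^ #parts v * q ^ #distinctParts v        ≡⟨ ≡.cong (λ d → t ^ #parts v * q ^ d) (#distinctParts-∷ 0 v) ⟨
    t ^ #parts v * q ^ #distinctParts (0 ∷ v)  ∎
  weigh-free {q} tq≈τ (suc k ∷ v) = begin
    t ^ k * τ * weigh (λ _ → free) v
      ≈⟨ *-cong (trans (*-congˡ (sym tq≈τ)) (trans (sym (*-assoc _ t q)) (*-congʳ (*-comm _ t))))
                (weigh-free tq≈τ v) ⟩
    t ^ suc k * q * (t ^ #parts v * q ^ #distinctParts v)
      ≈⟨ interchange _ q _ _ ⟩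
    t ^ suc k * t ^ #parts v * q ^ suc (#distinctParts v)
      ≈⟨ *-congʳ (^-homo-* t (suc k) (#parts v)) ⟨
    t ^ #parts (suc k ∷ v) * q ^ suc (#distinctParts v)
      ≡⟨ ≡.cong (λ d → t ^ #parts (suc k ∷ v) * q ^ d) (#distinctParts-∷ (suc k) v) ⟨
    t ^ #parts (suc k ∷ v) * q ^ #distinctParts (suc k ∷ v) ∎

  module _ (π : Vec ℕ N) {i₀} (0<πi₀ : 0 < lookup π i₀) (p r : ℕ) where

    private
      s = smallestPart π
      l = largestPart π

      window-inside : ∀ {j k} → p ≤ j → j ≤ p ℕ.+ r → window p r j (suc k) ≈ free (suc k)
      window-inside {j} {k} p≤j j≤ =
        reflexive (if-yes ((p ℕ.≤? j) ×-dec (j ℕ.≤? p ℕ.+ r)) (p≤j , j≤))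

      window-outside : ∀ {j k} → ¬ (p ≤ j × j ≤ p ℕ.+ r) → 0 < k → window p r j k ≈ 0#
      window-outside {j} {suc k} j∉ _ =
        reflexive (if-no ((p ℕ.≤? j) ×-dec (j ℕ.≤? p ℕ.+ r)) j∉)

      window-absent : ∀ {j} → j ≢ p ℕ.+ r → window p r j 0 ≈ 1#
      window-absent {j} neq = reflexive (if-no (j ℕ.≟ p ℕ.+ r) neq)

      window-missing : window p r (p ℕ.+ r) 0 ≈ 0#
      window-missing = reflexive (if-yes (p ℕ.+ r ℕ.≟ p ℕ.+ r) ≡.refl)

    -- Every part present lies in the window, so none is barred. A multiplicity 0 is penalised only
    -- at the index `p + r`, which belongs to the largest part and is therefore present.
    weigh-window-yes : p < s → l ≡ suc (p ℕ.+ r) → weigh (window p r) π ≈ weigh (λ _ → free) π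
    weigh-window-yes p<s l≡ = weigh-cong π local
      where
      local : ∀ i → window p r (toℕ i) (lookup π i) ≈ free (lookup π i)
      local i with lookup π i in eq
      ... | suc k = window-inside {k = k} (ℕ.≤-pred (ℕ.≤-trans p<s (smallestPart≤ π 0<πi)))
                                  (ℕ.≤-pred (≡.subst (part i ≤_) l≡ (≤largestPart π 0<πi)))
        where
        0<πi : 0 < lookup π i
        0<πi = ≡.subst (0 <_) (≡.sym eq) (s≤s z≤n)
      ... | zero = window-absent λ i≡ → top i≡ (largestPart-attained π 0<πi₀)
        where
        top : toℕ i ≡ p ℕ.+ r → ¬ (∃[ i′ ] l ≡ part i′ × 0 < lookup π i′)
        top i≡ (i′ , l≡′ , 0<πi′)
          with ≡.refl ← Fin.toℕ-injective {i = i} {j = i′}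
            (≡.trans i≡ (ℕ.suc-injective (≡.trans (≡.sym l≡) l≡′)))
          = ℕ.<⇒≢ 0<πi′ (≡.sym eq)

    -- A single vanishing factor suffices: the smallest part if it lies below the window, the
    -- largest part if it lies above, and otherwise the required part p + r + 1, which is absent.
    -- The bound `p + r < N` provides an index for the latter.
    weigh-window-no : p ℕ.+ r < N → ¬ (p < s × l ≡ suc (p ℕ.+ r)) → weigh (window p r) π ≈ 0#
    weigh-window-no p+r<N ¬window with p ℕ.<? s
    ... | no p≮s with i , s≡ , 0<πi ← smallestPart-attained π 0<πi₀ =
      weigh-zero π i (window-outside {k = lookup π i}
        (λ (p≤i , _) → p≮s (≡.subst (p <_) (≡.sym s≡) (s≤s p≤i))) 0<πi)
    ... | yes p<s with l ℕ.≤? suc (p ℕ.+ r)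
    ...   | no l≰ with i , l≡ , 0<πi ← largestPart-attained π 0<πi₀ =
      weigh-zero π i (window-outside {k = lookup π i}
        (λ (_ , i≤) → l≰ (≡.subst (_≤ suc (p ℕ.+ r)) (≡.sym l≡) (s≤s i≤))) 0<πi)
    ...   | yes l≤ = weigh-zero π i (trans (reflexive (≡.cong₂ (window p r) i≡ πi≡0)) window-missing)
      where
      i = Fin.fromℕ< p+r<N
      i≡ : toℕ i ≡ p ℕ.+ r
      i≡ = Fin.toℕ-fromℕ< p+r<N
      πi≡0 : lookup π i ≡ 0
      πi≡0 = ℕ.n≤0⇒n≡0 (ℕ.≮⇒≥ λ 0<πi → ¬window (p<s , ℕ.≤-antisym l≤
        (≡.subst (λ j → suc j ≤ l) i≡ (≤largestPart π 0<πi))))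

-- Double counting over windows and Abel summation.

module Assembly {c ℓ} (K : CommutativeRing c ℓ) (τ : CommutativeRing.Carrier K) where
  open CommutativeRing K hiding (zero)
  private t = 1# + τ
  open BigOperators commutativeSemiring
  open import Relation.Binary.Reasoning.Setoid setoid
  open import Algebra.Properties.CommutativeSemigroup *-commutativeSemigroup using (x∙yz≈y∙xz)
  open import Algebra.Solver.Ring.NaturalCoefficients.Default commutativeSemiring

  ∑-upTo-< : ∀ {s n} f → s ≤ n →
             ∑[ p ∈ upTo n ] (if does (p ℕ.<? s) then f p else 0#) ≈ ∑ (upTo s) f
  ∑-upTo-< {n = n} f z≤n = ∑-zero (upTo n) (λ _ → refl)
  ∑-upTo-< {suc s} {suc n} f (s≤s s≤n) = begin
    (∑[ p ∈ upTo (suc n) ] (if does (p ℕ.<? suc s) then f p else 0#))  ≈⟨ ∑-upTo-suc n _ ⟩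
    f 0 + (∑[ p ∈ upTo n ] (if does (p ℕ.<? s) then f (suc p) else 0#))
      ≈⟨ +-congˡ (∑-upTo-< (f ∘ suc) s≤n) ⟩
    f 0 + ∑ (upTo s) (f ∘ suc)                                         ≈⟨ ∑-upTo-suc s f ⟨
    ∑ (upTo (suc s)) f                                                 ∎

  cancel-difference : ∀ x y → x - y + y ≈ x
  cancel-difference x y = trans (+-assoc x (- y) y) (trans (+-congˡ (-‿inverseˡ y)) (+-identityʳ x))

  -- The boundary terms are kept on both sides so that the induction closes: the one at `m` cancels
  -- the subtracted part of the next summand, and the remaining `a (suc m) * γ m` is expanded by the
  -- hypothesis on γ.
  abel : ∀ (a γ δ : ℕ → Carrier) m → (∀ {r} → r < m → γ r ≈ t * γ (suc r) + δ r) →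
         (∑[ r ∈ upTo m ] (a (suc r) - t * a r) * γ r) + t * (a 0 * γ 0) ≈
         (∑[ r ∈ upTo m ] a (suc r) * δ r) + t * (a m * γ m)
  abel a γ δ zero    γ≈ = refl
  abel a γ δ (suc m) γ≈ = begin
    (∑[ r ∈ upTo (suc m) ] (a (suc r) - t * a r) * γ r) + z
      ≈⟨ +-congʳ (∑-upTo-∷ʳ m _) ⟩
    u + b * γ m + z
      ≈⟨ solve 3 (λ x y z → x :+ y :+ z := x :+ z :+ y) refl u (b * γ m) z ⟩
    u + z + b * γ m                             ≈⟨ +-congʳ (abel a γ δ m (γ≈ ∘ ℕ.m<n⇒m<1+n)) ⟩
    v + t * (a m * γ m) + b * γ m
      ≈⟨ solve 5 (λ v t x g b → v :+ t :* (x :* g) :+ b :* g := v :+ (b :+ t :* x) :* g)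
           refl v t (a m) (γ m) b ⟩
    v + (b + t * a m) * γ m                     ≈⟨ +-congˡ (*-cong (cancel-difference _ _) (γ≈ ℕ.≤-refl)) ⟩
    v + a (suc m) * (t * γ (suc m) + δ m)
      ≈⟨ solve 5 (λ v x t g d → v :+ x :* (t :* g :+ d) := v :+ x :* d :+ t :* (x :* g))
           refl v (a (suc m)) t (γ (suc m)) (δ m) ⟩
    v + a (suc m) * δ m + t * (a (suc m) * γ (suc m))   ≈⟨ +-congʳ (∑-upTo-∷ʳ m _) ⟨
    (∑[ r ∈ upTo (suc m) ] a (suc r) * δ r) + t * (a (suc m) * γ (suc m)) ∎
    where
    z = t * (a 0 * γ 0)
    u = ∑[ r ∈ upTo m ] (a (suc r) - t * a r) * γ r
    v = ∑[ r ∈ upTo m ] a (suc r) * δ r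
    b = a (suc m) - t * a m

  module _ (n : ℕ) .{{_ : NonZero n}} where
    open Counting commutativeSemiring τ n
    open Windows commutativeSemiring τ n using (S; G)
    open Pointwise commutativeSemiring τ n
    open Divisibility K τ n

    ∃-part : ∀ {π} → π ∈ P n → ∃[ i ] 0 < lookup π i
    ∃-part {π} π∈P = weight-positive π
      (≡.subst (0 <_) (≡.sym (Equivalence.to (∈-P π) π∈P)) (ℕ.>-nonZero⁻¹ n))

    inWindow? : ∀ (π : Vec ℕ n) p r → Dec (p < smallestPart π × largestPart π ≡ suc (p ℕ.+ r))
    inWindow? π p r = (p ℕ.<? smallestPart π) ×-dec (largestPart π ℕ.≟ suc (p ℕ.+ r))

    inWindow : Vec ℕ n → ℕ → ℕ → Carrier
    inWindow π p r = if does (inWindow? π p r) then weigh (λ _ → free) π else 0#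

    -- For p + r < n the condition is compared partition by partition with the local weights of
    -- `window`. Otherwise both sides vanish: no part exceeds `n`, and h_{p+r+1} is 0 modulo
    -- x^(n+1).
    ∑-inWindow : ∀ p r → ∑[ π ∈ P n ] inWindow π p r ≈ τ * G r p n
    ∑-inWindow p r with p ℕ.+ r ℕ.<? n
    ... | yes p+r<n = trans (∑-cong-∈ (P n) λ {π} π∈P → sym (local π (proj₂ (∃-part π∈P))))
                            (∑-window p r p+r<n)
      where
      local : ∀ π {i} → 0 < lookup π i → weigh (window p r) π ≈ inWindow π p r
      local π 0<πi with inWindow? π p r
      ... | yes (p<s , l≡) = trans (weigh-window-yes π 0<πi p r p<s l≡)
        (reflexive (≡.sym (if-yes (inWindow? π p r) (p<s , l≡))))
      ... | no ¬w = trans (weigh-window-no π 0<πi p r p+r<n ¬w)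
        (reflexive (≡.sym (if-no (inWindow? π p r) ¬w)))
    ... | no p+r≮n = trans
      (∑-zero (P n) λ {π} _ → reflexive (if-no (inWindow? π p r)
        λ (_ , l≡) → p+r≮n (≡.subst (_≤ n) l≡ (largestPart≤ π))))
      (sym (trans (*-congˡ (G-large p r (ℕ.≮⇒≥ p+r≮n) n ℕ.≤-refl)) (zeroʳ τ)))

    module _ (b : ℕ → Carrier) where

      Φ : Vec ℕ n → Carrier
      Φ π = ∑[ j ∈ upTo (smallestPart π) ] b (largestPart π ∸ smallestPart π ℕ.+ j)

      -- Each `p < s` fits exactly one `r`, namely `l ∸ suc p`, and no other `p` fits any. Reversing
      -- the order of the `s` terms turns the indices l - 1 - p into l - s + j.
      ∑-windows : ∀ {π} → π ∈ P n →
        ∑[ p ∈ upTo n ] ∑[ r ∈ upTo n ] b r * inWindow π p r ≈ weigh (λ _ → free) π * Φ π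
      ∑-windows {π} π∈P = begin
        (∑[ p ∈ upTo n ] ∑[ r ∈ upTo n ] b r * inWindow π p r)
          ≈⟨ ∑-cong (upTo n) single ⟩
        (∑[ p ∈ upTo n ] (if does (p ℕ.<? s) then F * b (l ∸ suc p) else 0#))
          ≈⟨ ∑-upTo-< (λ p → F * b (l ∸ suc p)) (ℕ.≤-trans s≤l l≤n) ⟩
        (∑[ p ∈ upTo s ] F * b (l ∸ suc p))
          ≈⟨ *-∑ F (upTo s) (λ p → b (l ∸ suc p)) ⟨
        F * (∑[ p ∈ upTo s ] b (l ∸ suc p))
          ≈⟨ *-congˡ {F} (∑-cong-∈ (upTo s) (λ {p} p∈ →
               reflexive (≡.cong b (shift p (∈-upTo⁻ p∈))))) ⟨
        F * (∑[ p ∈ upTo s ] b (l ∸ s ℕ.+ (s ∸ suc p)))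
          ≈⟨ *-congˡ {F} (∑-upTo-reverse s (λ j → b (l ∸ s ℕ.+ j))) ⟨
        F * Φ π ∎
        where
        s = smallestPart π
        l = largestPart π
        F = weigh (λ _ → free) π
        s≤l : s ≤ l
        s≤l = smallestPart≤largestPart π (proj₂ (∃-part π∈P))
        l≤n : l ≤ n
        l≤n = largestPart≤ π
        shift : ∀ p → p < s → l ∸ s ℕ.+ (s ∸ suc p) ≡ l ∸ suc p
        shift p p<s = ≡.trans (≡.sym (ℕ.+-∸-assoc (l ∸ s) p<s))
                              (≡.cong (_∸ suc p) (ℕ.m∸n+n≡m s≤l))
        single : ∀ p → ∑[ r ∈ upTo n ] b r * inWindow π p r ≈
                       (if does (p ℕ.<? s) then F * b (l ∸ suc p) else 0#)
        single p with p ℕ.<? s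
        ... | no p≮s = trans
          (∑-zero (upTo n) (λ {r} _ → trans
            (*-congˡ (reflexive (if-no (inWindow? π p r) (p≮s ∘ proj₁)))) (zeroʳ (b r))))
          (reflexive (≡.sym (if-no (p ℕ.<? s) p≮s)))
        ... | yes p<s = begin
          (∑[ r ∈ upTo n ] b r * inWindow π p r)
            ≈⟨ ∑-upTo-single {m = l ∸ suc p} _
                 (ℕ.≤-trans (ℕ.∸-monoʳ-< {l} (s≤s (z≤n {p})) (ℕ.≤-trans p<s s≤l)) l≤n)
                 (λ {r} r≢ → trans (*-congˡ (reflexive (if-no (inWindow? π p r) λ (_ , l≡) → r≢
                   (≡.sym (≡.trans (≡.cong (_∸ suc p) l≡) (ℕ.m+n∸m≡n (suc p) r)))))) (zeroʳ (b r))) ⟩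
          b (l ∸ suc p) * inWindow π p (l ∸ suc p)
            ≈⟨ *-congˡ (reflexive (if-yes (inWindow? π p (l ∸ suc p))
                 (p<s , ≡.sym (ℕ.m+[n∸m]≡n (ℕ.≤-trans p<s s≤l))))) ⟩
          b (l ∸ suc p) * F        ≈⟨ *-comm _ F ⟩
          F * b (l ∸ suc p)        ≡⟨ if-yes (p ℕ.<? s) p<s ⟨
          (if does (p ℕ.<? s) then F * b (l ∸ suc p) else 0#) ∎

      -- The triples (π, p, r) are counted in two ways: a fixed π yields `Φ π` with its weight,
      -- while fixed `p` and `r` yield a coefficient of `G r p`, and these add up over `p` to
      -- `S r n`.
      ∑-P : ∑[ π ∈ P n ] weigh (λ _ → free) π * Φ π ≈ τ * (∑[ r ∈ upTo n ] b r * S r n n)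
      ∑-P = begin
        (∑[ π ∈ P n ] weigh (λ _ → free) π * Φ π)
          ≈⟨ ∑-cong-∈ (P n) ∑-windows ⟨
        (∑[ π ∈ P n ] ∑[ p ∈ upTo n ] ∑[ r ∈ upTo n ] b r * inWindow π p r)
          ≈⟨ ∑-swap (P n) (upTo n) _ ⟩
        (∑[ p ∈ upTo n ] ∑[ π ∈ P n ] ∑[ r ∈ upTo n ] b r * inWindow π p r)
          ≈⟨ ∑-cong (upTo n) (λ p → ∑-swap (P n) (upTo n) _) ⟩
        (∑[ p ∈ upTo n ] ∑[ r ∈ upTo n ] ∑[ π ∈ P n ] b r * inWindow π p r)
          ≈⟨ ∑-swap (upTo n) (upTo n) _ ⟩
        (∑[ r ∈ upTo n ] ∑[ p ∈ upTo n ] ∑[ π ∈ P n ] b r * inWindow π p r)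
          ≈⟨ ∑-cong (upTo n) inner ⟩
        (∑[ r ∈ upTo n ] τ * (b r * S r n n))
          ≈⟨ *-∑ τ (upTo n) (λ r → b r * S r n n) ⟨
        τ * (∑[ r ∈ upTo n ] b r * S r n n) ∎
        where
        inner : ∀ r → ∑[ p ∈ upTo n ] ∑[ π ∈ P n ] b r * inWindow π p r ≈ τ * (b r * S r n n)
        inner r = begin
          (∑[ p ∈ upTo n ] ∑[ π ∈ P n ] b r * inWindow π p r)
            ≈⟨ ∑-cong (upTo n) (λ p → trans (sym (*-∑ (b r) (P n) (λ π → inWindow π p r)))
                 (trans (*-congˡ (∑-inWindow p r)) (x∙yz≈y∙xz (b r) τ _))) ⟩
          (∑[ p ∈ upTo n ] τ * (b r * G r p n))
            ≈⟨ trans (*-congˡ (*-∑ (b r) (upTo n) (λ p → G r p n)))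
                     (*-∑ τ (upTo n) (λ p → b r * G r p n)) ⟨
          τ * (b r * (∑[ p ∈ upTo n ] G r p n))
            ≈⟨ *-congˡ (*-congˡ (∑-coefficient (upTo n) (G r))) ⟨
          τ * (b r * S r n n) ∎

    ∑-divisors : ∀ a → ∑[ r ∈ upTo n ] a (suc r) * [ suc r ∣ n ] ≈ ∑ (divisors n) a
    ∑-divisors a = sym (trans (∑-filter (_∣? n) [1⋯ n ] a)
      (trans (∑-map suc (upTo n) _) (∑-cong (upTo n) (λ r → local r n))))
      where
      if-* : ∀ (d : Bool) x → (if d then x else 0#) ≈ x * (if d then 1# else 0#)
      if-* true  x = sym (*-identityʳ x)
      if-* false x = sym (zeroʳ x)
      -- `n` is generalised to `m` so that it can be matched as a successor, where the indicator
      -- unfolds to the divisibility test.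
      local : ∀ r m .{{_ : NonZero m}} →
              (if does (suc r ∣? m) then a (suc r) else 0#) ≈ a (suc r) * [ suc r ∣ m ]
      local r (suc m) = if-* (does (suc r ∣? suc m)) (a (suc r))

    ∑-P-divisors : ∀ a → a 0 ≈ 0# →
      ∑[ π ∈ P n ] weigh (λ _ → free) π * Φ (λ r → a (suc r) - t * a r) π ≈ τ * ∑ (divisors n) a
    ∑-P-divisors a a0≈0 = trans (∑-P b) (*-congˡ (begin
      (∑[ r ∈ upTo n ] b r * S r n n)              ≈⟨ +-identityʳ _ ⟨
      (∑[ r ∈ upTo n ] b r * S r n n) + 0#
        ≈⟨ +-congˡ (trans (*-congˡ (trans (*-congʳ a0≈0) (zeroˡ (S 0 n n)))) (zeroʳ t)) ⟨
      (∑[ r ∈ upTo n ] b r * S r n n) + t * (a 0 * S 0 n n)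
        ≈⟨ abel a (λ r → S r n n) (λ r → [ suc r ∣ n ]) n (λ {r} _ → S-divisor r n ℕ.≤-refl) ⟩
      (∑[ r ∈ upTo n ] a (suc r) * [ suc r ∣ n ]) + t * (a n * S n n n)
        ≈⟨ +-cong (∑-divisors a) (trans (*-congˡ (trans (*-congˡ Sₙ≈0) (zeroʳ (a n)))) (zeroʳ t)) ⟩
      ∑ (divisors n) a + 0#                        ≈⟨ +-identityʳ _ ⟩
      ∑ (divisors n) a                             ∎))
      where
      b : ℕ → Carrier
      b r = a (suc r) - t * a r
      -- The upper boundary term of the Abel summation: every summand `G n p` involves a largest
      -- part p + n + 1 > n.
      Sₙ≈0 : S n n n ≈ 0#
      Sₙ≈0 = trans (∑-coefficient (upTo n) (G n))
        (∑-zero (upTo n) (λ {p} _ → G-large p n (ℕ.m≤n+m n p) n ℕ.≤-refl))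

-- Passage to the field: restoring and cancelling the factor `τ`.

corollary2 : ∀ {c ℓ₁ ℓ₂} (F : HeytingField c ℓ₁ ℓ₂) →
    let open HeytingField F
        open FieldOperations F
    in
    (a : ℕ → Carrier) → a 0 ≈ 0# →
    (t : Carrier) (t#0 : t # 0#) → t # 1# →
    (n : ℕ) .{{_ : NonZero n}} →
    (∑[ π ∈ P n ]
       (t ^ (#parts π ∸ 1)
         * ((t - 1#) / t [ t#0 ]) ^ (#distinctParts π ∸ 1)
         * (∑[ j ∈ [1⋯ smallestPart π ] ]
              (a (largestPart π ∸ smallestPart π ℕ.+ j)
                - t * a (largestPart π ∸ smallestPart π ℕ.+ j ∸ 1)))))
    ≈ (∑[ d ∈ divisors n ] a d)
corollary2 F a a0≈0 t t#0 t#1 n = *-cancelˡ-invertible (begin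
  τ * (∑[ π ∈ P n ] W π * Ψ π)                       ≈⟨ *-∑ τ (P n) (λ π → W π * Ψ π) ⟩
  (∑[ π ∈ P n ] τ * (W π * Ψ π))                     ≈⟨ ∑-cong-∈ (P n) τ*summand ⟩
  (∑[ π ∈ P n ] weigh (λ _ → free) π * Φ n b π)      ≈⟨ ∑-P-divisors n a a0≈0 ⟩
  τ * ∑ (divisors n) a                               ∎)
  where
  open HeytingField F using (#⇒invertible; heytingCommutativeRing)
  open FieldOperations F using (_/_[_]; _⁻¹[_]; ⁻¹-inverseʳ)
  K = HeytingCommutativeRing.commutativeRing heytingCommutativeRing
  open CommutativeRing K hiding (zero)
  τ = t - 1#
  q = τ / t [ t#0 ]
  open BigOperators commutativeSemiring
  open Assembly K τ
  open Counting commutativeSemiring τ n using (free; weigh)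
  open Pointwise commutativeSemiring τ n using (weigh-free)
  open import Relation.Binary.Reasoning.Setoid setoid
  open import Algebra.Properties.CommutativeSemiring.Exp commutativeSemiring using (_^_; ^-congˡ)
  open import Algebra.Properties.CommutativeSemigroup *-commutativeSemigroup
    using (interchange; x∙yz≈y∙xz)

  b : ℕ → Carrier
  b r = a (suc r) - (1# + τ) * a r

  W Ψ : Vec ℕ n → Carrier
  W π = t ^ (#parts π ∸ 1) * q ^ (#distinctParts π ∸ 1)
  Ψ π = ∑[ j ∈ [1⋯ smallestPart π ] ]
          (a (largestPart π ∸ smallestPart π ℕ.+ j)
            - t * a (largestPart π ∸ smallestPart π ℕ.+ j ∸ 1))

  1+τ≈t : 1# + τ ≈ t
  1+τ≈t = trans (+-comm 1# τ) (cancel-difference t 1#)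

  t*q≈τ : t * q ≈ τ
  t*q≈τ = trans (x∙yz≈y∙xz t τ _) (trans (*-congˡ (⁻¹-inverseʳ t t#0)) (*-identityʳ τ))

  -- The apartness of `t` and 1 yields an inverse of their difference, which is `τ` itself.
  *-cancelˡ-invertible : ∀ {x y} → τ * x ≈ τ * y → x ≈ y
  *-cancelˡ-invertible {x} {y} τx≈τy with τ⁻¹ , τ⁻¹τ≈1 , _ ← #⇒invertible t#1 = begin
    x                ≈⟨ trans (sym (*-assoc τ⁻¹ τ x)) (trans (*-congʳ τ⁻¹τ≈1) (*-identityˡ x)) ⟨
    τ⁻¹ * (τ * x)    ≈⟨ *-congˡ τx≈τy ⟩
    τ⁻¹ * (τ * y)    ≈⟨ trans (sym (*-assoc τ⁻¹ τ y)) (trans (*-congʳ τ⁻¹τ≈1) (*-identityˡ y)) ⟩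
    y                ∎

  ^-pred : ∀ x {k} → 0 < k → x ^ k ≈ x * x ^ (k ∸ 1)
  ^-pred x {suc k} _ = refl

  Ψ≈Φ : ∀ π → Ψ π ≈ Φ n b π
  Ψ≈Φ π = trans (∑-map suc (upTo (smallestPart π)) _)
    (∑-cong (upTo (smallestPart π)) λ j → begin
      a (d ℕ.+ suc j) - t * a (d ℕ.+ suc j ∸ 1)
        -- The summation index starts at 1, so the `∸ 1` in the index of `a` is a genuine
        -- predecessor.
        ≡⟨ ≡.cong (λ k → a k - t * a (k ∸ 1)) (ℕ.+-suc d j) ⟩
      a (suc (d ℕ.+ j)) - t * a (d ℕ.+ j)
        ≈⟨ +-congˡ (-‿cong (*-congʳ 1+τ≈t)) ⟨
      b (d ℕ.+ j) ∎)
    where d = largestPart π ∸ smallestPart π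

  -- Since τ = t q, multiplying by `τ` supplies one `t` and one `q`, which are what the exponents
  -- lowered by one lack. As `n` is positive, π has a part, so neither `∸ 1` is truncated.
  τ*W : ∀ {π} → π ∈ P n → τ * W π ≈ weigh (λ _ → free) π
  τ*W {π} π∈P with _ , 0<πi ← ∃-part n π∈P = begin
    τ * W π                                               ≈⟨ *-congʳ t*q≈τ ⟨
    t * q * W π                                           ≈⟨ interchange t q _ _ ⟩
    t * t ^ (#parts π ∸ 1) * (q * q ^ (#distinctParts π ∸ 1))
      ≈⟨ *-cong (^-pred t (#parts-positive π 0<πi)) (^-pred q (#distinctParts-positive π 0<πi)) ⟨
    t ^ #parts π * q ^ #distinctParts π                   ≈⟨ *-congʳ (^-congˡ (#parts π) 1+τ≈t) ⟨
    (1# + τ) ^ #parts π * q ^ #distinctParts π            ≈⟨ weigh-free (trans (*-congʳ 1+τ≈t) t*q≈τ) π ⟨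
    weigh (λ _ → free) π                                  ∎

  τ*summand : ∀ {π} → π ∈ P n → τ * (W π * Ψ π) ≈ weigh (λ _ → free) π * Φ n b π
  τ*summand {π} π∈P = trans (sym (*-assoc τ (W π) (Ψ π))) (*-cong (τ*W π∈P) (Ψ≈Φ π))
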